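{- For all $t,r\in\mathbb{N}$, there exists a polynomial $f=f_{t,r}$ such that the following holds. Let $C,s\in\mathbb{N}$ with $C\ge 2$, let $G$ be a $K_{t,t}$-induced-minor-free graph with $\omega(G)<s$, and let $Y\subseteq V(G)$. Then there is a subset $X\subseteq V(G)$ with $|X|\le f(Cs)$ such that for every $v\in V(G)\setminus X$ we have $$|N^{r}_{G\setminus X}[v]\cap Y|\le\frac{|Y|}{C}.$$
   Context: All graphs are finite and simple; $\mathbb{N}$ denotes the positive integers. $\omega(G)$ is the maximum size of a clique of $G$. A graph $H$ is an induced minor of $G$ if $H$ can be obtained from $G$ by a sequence of vertex deletions and edge contractions (deleting parallel edges created in the process); $G$ is $K_{t,t}$-induced-minor-free if $K_{t,t}$ is not an induced minor of $G$. For $X\subseteq V(G)$, $G\setminus X$ is the subgraph of $G$ induced by $V(G)\setminus X$. $N^r_{H}[v]$ is the set of vertices of $H$ at distance at most $r$ from $v$ in $H$. -}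

module Defs where

open import Data.Bool.Base using (Bool; true; false)
import Data.Bool.Properties as Bool
open import Data.Fin.Base using (Fin; splitAt)
open import Data.Fin.Properties using (_≟_; all?; any?)
open import Data.Fin.Subset using (Subset; inside; outside; _∈_; _∉_; _⊆_; ⊤; _─_; _-_; ⁅_⁆; ∣_∣)
open import Data.Fin.Subset.Properties
  using (_∈?_; _⊆?_; ∈⊤; x∈p∧x∉q⇒x∈p─q; x∈p∧x≢y⇒x∈p-y)
open import Data.List.Base using (List; []; _∷_; _++_; foldr; map; filter)
open import Data.List.Extrema.Nat using (max)
open import Data.Nat.Base using (ℕ; zero; suc; _+_; _*_; _≤_; s≤s; s≤s⁻¹)
open import Data.Nat.Properties using (anyUpTo?)
open import Data.Product.Base using (Σ; ∃-syntax; _×_; _,_; proj₁; proj₂)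
open import Data.Sum.Base using (_⊎_; inj₁; inj₂; [_,_]′)
open import Data.Vec.Base using ([]; _∷_; tabulate)
open import Function.Base using (const)
open import Function.Bundles using (_↔_; _⇔_; Inverse)
open import Level using (0ℓ)
open import Relation.Binary.Core using (Rel)
open import Relation.Binary.Definitions using (Symmetric; Decidable)
open import Relation.Binary.PropositionalEquality
  using (_≡_; _≢_; refl; sym; subst; ≢-sym)
open import Relation.Nullary using (¬_; Dec; does; ¬?; _×-dec_; _⊎-dec_; _→-dec_)
open import Relation.Nullary.Decidable using (map′)

-- The vertex set is an arbitrary subset of Fin n, so subgraphs and minors of G
-- keep the vertex names of G.  Adjacency is decidable because constructively
-- a finite graph is given by its (Boolean) adjacency matrix.
record Graph (n : ℕ) : Set₁ where
  infix 4 _~_ _~?_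
  field
    V        : Subset n
    _~_      : Rel (Fin n) 0ℓ
    _~?_     : Decidable _~_
    ~-sym    : Symmetric _~_
    ~-irrefl : ∀ {u} → ¬ (u ~ u)
    ~⇒∈      : ∀ {u v} → u ~ v → u ∈ V

open Graph public using (V)

infixl 6 _∖_

_∖_ : ∀ {n} → Graph n → Subset n → Graph n
G ∖ X = record
  { V        = V G ─ X
  ; _~_      = λ u v → u ~ v × u ∉ X × v ∉ X
  ; _~?_     = λ u v → (u ~? v) ×-dec ¬? (u ∈? X) ×-dec ¬? (v ∈? X)
  ; ~-sym    = λ (e , u∉X , v∉X) → ~-sym e , v∉X , u∉X
  ; ~-irrefl = λ (e , _) → ~-irrefl e
  ; ~⇒∈      = λ (e , u∉X , _) → x∈p∧x∉q⇒x∈p─q (~⇒∈ e) u∉X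
  }
  where open Graph G hiding (V)

-- Contraction of the edge uv: the merged vertex is called u and v disappears.
-- Since _~_ is a relation, no parallel edges arise.
contract : ∀ {n} (G : Graph n) {u v : Fin n} → Graph._~_ G u v → Graph n
contract {n} G {u} {v} uv = record
  { V        = V G - v
  ; _~_      = _~′_
  ; _~?_     = λ a b → ¬? (a ≟ v) ×-dec ¬? (b ≟ v) ×-dec ¬? (a ≟ b) ×-dec
                       ((a ~? b) ⊎-dec ((a ≟ u) ×-dec (v ~? b))
                                 ⊎-dec ((b ≟ u) ×-dec (a ~? v)))
  ; ~-sym    = λ (a≢v , b≢v , a≢b , e) → b≢v , a≢v , ≢-sym a≢b , flip-edge e
  ; ~-irrefl = λ (_ , _ , a≢a , _) → a≢a refl
  ; ~⇒∈      = λ (a≢v , _ , _ , e) → x∈p∧x≢y⇒x∈p-y (edge⇒∈ e) a≢v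
  }
  where
  open Graph G using (_~_; _~?_; ~-sym; ~⇒∈)

  Edge : Rel (Fin n) 0ℓ
  Edge a b = a ~ b ⊎ (a ≡ u × v ~ b) ⊎ (b ≡ u × a ~ v)

  _~′_ : Rel (Fin n) 0ℓ
  a ~′ b = a ≢ v × b ≢ v × a ≢ b × Edge a b

  flip-edge : Symmetric Edge
  flip-edge (inj₁ e)              = inj₁ (~-sym e)
  flip-edge (inj₂ (inj₁ (p , e))) = inj₂ (inj₂ (p , ~-sym e))
  flip-edge (inj₂ (inj₂ (p , e))) = inj₂ (inj₁ (p , ~-sym e))

  edge⇒∈ : ∀ {a b} → Edge a b → a ∈ V G
  edge⇒∈ (inj₁ e)              = ~⇒∈ e
  edge⇒∈ (inj₂ (inj₁ (p , _))) = subst (_∈ V G) (sym p) (~⇒∈ uv)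
  edge⇒∈ (inj₂ (inj₂ (_ , e))) = ~⇒∈ e

Vertex : ∀ {n} → Graph n → Set
Vertex {n} G = Σ (Fin n) (_∈ V G)

infix 4 _≅_ _≼_

record _≅_ {m n} (H : Graph m) (G : Graph n) : Set where
  open Graph H using () renaming (_~_ to _~ᴴ_)
  open Graph G using () renaming (_~_ to _~ᴳ_)
  field
    bijection : Vertex H ↔ Vertex G

  open Inverse bijection using (to)

  field
    adjacency : ∀ u v → (proj₁ u ~ᴴ proj₁ v) ⇔ (proj₁ (to u) ~ᴳ proj₁ (to v))

-- H ≼ G : H is an induced minor of G.
data _≼_ {m n} (H : Graph m) (G : Graph n) : Set₁ where
  iso  : H ≅ G → H ≼ G
  del  : ∀ {v} → v ∈ V G → H ≼ G ∖ ⁅ v ⁆ → H ≼ G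
  cont : ∀ {u v} (uv : Graph._~_ G u v) → H ≼ contract G uv → H ≼ G

K : (a b : ℕ) → Graph (a + b)
K a b = record
  { V        = ⊤
  ; _~_      = λ u v → side u ≢ side v
  ; _~?_     = λ u v → ¬? (side u Bool.≟ side v)
  ; ~-sym    = ≢-sym
  ; ~-irrefl = λ u≢u → u≢u refl
  ; ~⇒∈      = λ _ → ∈⊤
  }
  where
  side : Fin (a + b) → Bool
  side u = [ const true , const false ]′ (splitAt a u)

InducedMinorFree : ∀ {m n} → Graph m → Graph n → Set₁
InducedMinorFree H G = ¬ (H ≼ G)

IsClique : ∀ {n} → Graph n → Subset n → Set
IsClique G S = S ⊆ V G × (∀ u v → u ∈ S → v ∈ S → u ≢ v → u ~ v)
  where open Graph G hiding (V)

isClique? : ∀ {n} (G : Graph n) (S : Subset n) → Dec (IsClique G S)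
isClique? G S = (S ⊆? V G) ×-dec
  all? λ u → all? λ v → (u ∈? S) →-dec (v ∈? S) →-dec ¬? (u ≟ v) →-dec (u ~? v)
  where open Graph G hiding (V)

subsets : ∀ n → List (Subset n)
subsets zero    = [] ∷ []
subsets (suc n) = map (inside ∷_) (subsets n) ++ map (outside ∷_) (subsets n)

-- The default value 0 is harmless: the empty set is always a clique.
ω : ∀ {n} → Graph n → ℕ
ω {n} G = max 0 (map ∣_∣ (filter (isClique? G) (subsets n)))

data Walk {n} (H : Graph n) : ℕ → Rel (Fin n) 0ℓ where
  []  : ∀ {v} → v ∈ V H → Walk H 0 v v
  _∷_ : ∀ {k u v w} → Graph._~_ H u v → Walk H k v w → Walk H (suc k) u w

walk? : ∀ {n} (H : Graph n) k → Decidable (Walk H k)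
walk? H zero u w = map′ (λ { (u∈V , refl) → [] u∈V }) (λ { ([] u∈V) → u∈V , refl })
  ((u ∈? V H) ×-dec (u ≟ w))
walk? H (suc k) u w = map′ (λ (_ , e , p) → e ∷ p) (λ { (e ∷ p) → _ , e , p })
  (any? λ v → (u ~? v) ×-dec walk? H k v w)
  where open Graph H hiding (V)

-- dist H u w ≤ r, the distance being the least length of a walk (it is
-- infinite, hence this is false, when u and w are in different components).
Dist≤ : ∀ {n} → Graph n → ℕ → Rel (Fin n) 0ℓ
Dist≤ H r u w = ∃[ k ] (k ≤ r × Walk H k u w)

dist≤? : ∀ {n} (H : Graph n) r → Decidable (Dist≤ H r)
dist≤? H r u w = map′ (λ (k , k<1+r , p) → k , s≤s⁻¹ k<1+r , p) (λ (k , k≤r , p) → k , s≤s k≤r , p)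
  (anyUpTo? (λ k → walk? H k u w) (suc r))

N[_] : ∀ {n} → ℕ → Graph n → Fin n → Subset n
N[ r ] H v = tabulate λ w → does (dist≤? H r v w)

-- Coefficients, constant term first.  Natural coefficients lose no generality
-- for upper bounds at natural arguments: a real coefficient may be replaced by
-- the ceiling of its absolute value.
Polynomial : Set
Polynomial = List ℕ

eval : Polynomial → ℕ → ℕ
eval p x = foldr (λ a y → a + x * y) 0 p

{-# OPTIONS --safe #-}

-- Induction on the radius, with the single parameter x = C s.  Having removed X so that every
-- r-ball contains at most a tiny fraction x^(-a) of Y, also remove all bad vertices, those whose
-- (r+1)-ball contains more than |Y|/x of Y.  There are fewer than polynomially many of them:
-- otherwise some independent bad vertices b₁, …, bₜ have a common set Y₁ of at least |Y|/poly(x)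
-- vertices at distance exactly r+1 from each bᵢ.  The paths from y ∈ Y₁ to neighbours of the bᵢ
-- form a connected bag adjacent to every bᵢ and contained in the r-ball of y.  As r-balls are
-- small, polynomially many bags are pairwise disjoint.  If t of these are also pairwise
-- anticomplete, they form an induced K_{t,t} minor with the bᵢ.  If not, then for some pair of
-- positions p, q there are many edges between the p-th vertices and the q-th vertices of the
-- bags, which yields an induced K_{t,t}.
-- Ramsey's theorem is needed only for independent sets of the fixed size t, where x^t vertices
-- suffice; this is what keeps every bound polynomial in x.

module Submission where

open import Defs
open import Data.Nat.Base using (ℕ; NonZero; _*_; _≤_; _<_)
open import Data.Integer.Base using (+_)
open import Data.Rational.Unnormalised.Base using (_/_) renaming (_≤_ to _≤ᵘ_)
open import Data.Fin.Base using (Fin)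
open import Data.Fin.Subset using (Subset; _∈_; _⊆_; _─_; _∩_; ∣_∣)
open import Data.Product.Base using (Σ-syntax; _×_)

open import Data.Fin.Base using (zero; suc; fromℕ; fromℕ<; combine; remQuot; splitAt; join)
open import Data.Fin.Properties using (_≟_; all?; any?; join-splitAt; splitAt-join; remQuot-combine)
open import Data.Fin.Subset using (inside; outside; _∉_; _∪_; _-_; ⊥; ⋃; ⁅_⁆)
open import Data.Fin.Subset.Properties
  using ( _∈?_; ∈⊤; ∉⊥; x∈⁅x⁆; x∈⁅y⁆⇒x≡y; x≢y⇒x∉⁅y⁆; ∣⊥∣≡0; ∣⁅x⁆∣≡1; p⊆q⇒∣p∣≤∣q∣; x∈p∩q⁺; x∈p∩q⁻
        ; x∈p∪q⁺; x∈p∪q⁻; p─q⊆p; x∈p∧x∉q⇒x∈p─q; x∈p∧x≢y⇒x∈p-y; x∈p⇒∣p-x∣<∣p∣)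
import Data.Integer.Base as ℤ
import Data.Integer.Properties as ℤ
open import Data.List.Base
  using (List; []; _∷_; length; filter; map; take; allFin; cartesianProduct; cartesianProductWith)
open import Data.List.Extrema.Nat using (v≤max⁺)
import Data.List.Membership.Propositional as List
open import Data.List.Membership.Propositional.Properties
  using ( ∈-allFin; ∈-cartesianProduct⁺; ∈-cartesianProductWith⁺; ∈-cartesianProductWith⁻
        ; ∈-filter⁺; ∈-filter⁻; ∈-length; ∈-map⁺; ∈-++⁺ˡ; ∈-++⁺ʳ)
open import Data.List.Properties
  using (filter-accept; filter-reject; length-++; length-filter; length-map; length-tabulate; length-take)
open import Data.List.Relation.Unary.All as All using (All; []; _∷_)
import Data.List.Relation.Unary.All.Properties as All
open import Data.List.Relation.Unary.AllPairs as AllPairs using (AllPairs; []; _∷_)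
import Data.List.Relation.Unary.AllPairs.Properties as AllPairs
open import Data.List.Relation.Unary.Any as Any using (here; there)
open import Data.List.Relation.Unary.Unique.Propositional using (Unique)
import Data.List.Relation.Unary.Unique.Propositional.Properties as Unique
open import Data.Maybe.Base as Maybe using (Maybe; just; nothing)
import Data.Maybe.Properties as Maybe
open import Data.Nat.Base using (_+_; _^_; zero; suc; z≤n; s≤s; s≤s⁻¹; >-nonZero; >-nonZero⁻¹)
open import Data.Nat.Induction using (<-wellFounded)
open import Data.Nat.ListAction using (sum)
open import Data.Nat.Properties hiding (_≟_)
import Data.Nat.Properties as ℕ
open import Data.Nat.Tactic.RingSolver using (solve-∀)
open import Data.Product.Base using (Σ; ∃; ∃-syntax; _,_; proj₁; proj₂)
open import Data.Rational.Unnormalised.Base using (*≤*)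
open import Data.Sum.Base using (_⊎_; inj₁; inj₂; [_,_]′)
open import Data.Unit.Base using (⊤; tt)
open import Data.Vec.Base using (Vec; []; _∷_; here; there; lookup; tabulate)
open import Data.Vec.Properties using (lookup∘tabulate; lookup⇒[]=; []=⇒lookup)
open import Data.Vec.Properties.WithK using ([]=-irrelevant)
open import Data.Bool.Base using (true; false)
open import Function.Base using (_∘_; case_of_; const; flip)
open import Function.Bundles using (mk↔ₛ′; mk⇔)
open import Induction.WellFounded using (Acc; acc)
open import Level using (0ℓ)
open import Relation.Binary.Construct.Closure.ReflexiveTransitive as Star using (Star; ε; _◅_; _◅◅_)
open import Relation.Binary.Core using (Rel; REL)
open import Relation.Binary.Definitions using (Symmetric) renaming (Decidable to Decidable₂)
open import Relation.Binary.PropositionalEquality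
  using (_≡_; _≢_; refl; sym; trans; cong; cong₂; subst; subst₂; module ≡-Reasoning)
open import Relation.Nullary using (¬_; Dec; yes; no; does; ¬?; _×-dec_; _→-dec_; contradiction)
open import Relation.Nullary.Decidable using (decidable-stable; dec-true)
open import Relation.Unary using (Pred; Decidable)

private variable
  A B J : Set

-- Counting in lists and the pigeonhole principle

count : {P : Pred A 0ℓ} → Decidable P → List A → ℕ
count P? xs = length (filter P? xs)

module _ {P Q : Pred A 0ℓ} (P? : Decidable P) (Q? : Decidable Q) where

  count-filter : ∀ xs → count P? (filter Q? xs) ≤ count P? xs
  count-filter [] = z≤n
  count-filter (x ∷ xs) with Q? x
  count-filter (x ∷ xs) | yes _ with P? x
  ... | yes _ = s≤s (count-filter xs)
  ... | no _  = count-filter xs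
  count-filter (x ∷ xs) | no _ with P? x
  ... | yes _ = m≤n⇒m≤1+n (count-filter xs)
  ... | no _  = count-filter xs

module _ {P : Pred A 0ℓ} (P? : Decidable P) where

  count-∁ : ∀ xs → count P? xs + count (¬? ∘ P?) xs ≡ length xs
  count-∁ [] = refl
  count-∁ (x ∷ xs) with P? x
  ... | yes _ = cong suc (count-∁ xs)
  ... | no _  = trans (+-suc _ _) (cong suc (count-∁ xs))

positive-factor : ∀ a {b c} → 1 ≤ c → c ≤ a * b → 1 ≤ b
positive-factor a {zero}  1≤c c≤ = contradiction (≤-trans 1≤c (≤-trans c≤ (≤-reflexive (*-zeroʳ a)))) λ ()
positive-factor a {suc _} _   _  = s≤s z≤n

nonempty : ∀ {xs : List A} → 1 ≤ length xs → ∃[ x ] x List.∈ xs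
nonempty {xs = x ∷ _} _ = x , here refl

module _ {Q : REL J A 0ℓ} (Q? : Decidable₂ Q) where

  -- If the head `j` covers too few elements, it misses more than `m * c` of them. The index found
  -- by induction for the missed ones then covers more than `c` elements, which also pays for those
  -- removed with `j`.
  pigeonhole : ∀ js xs → 1 ≤ length xs → (∀ {x} → x List.∈ xs → ∃[ j ] (j List.∈ js × Q j x)) →
               ∃[ j ] (j List.∈ js × length xs ≤ length js * count (Q? j) xs)
  pigeonhole [] (x ∷ xs) _ cover with () ← proj₁ (proj₂ (cover (here refl)))
  pigeonhole (j ∷ js) xs 1≤xs cover
    with length xs ≤? length (j ∷ js) * count (Q? j) xs
  ... | yes le = j , here refl , le
  ... | no ¬le = conclude (pigeonhole js rest 1≤rest cover′)
    where
    rest = filter (¬? ∘ Q? j) xs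
    m = length js
    c = count (Q? j) xs

    mc<rest : m * c < length rest
    mc<rest = +-cancelˡ-< c _ _ (subst (c + m * c <_) (sym (count-∁ (Q? j) xs)) (≰⇒> ¬le))

    1≤rest : 1 ≤ length rest
    1≤rest = ≤-trans (s≤s z≤n) mc<rest

    cover′ : ∀ {x} → x List.∈ rest → ∃[ j′ ] (j′ List.∈ js × Q j′ x)
    cover′ x∈ with x∈xs , ¬q ← ∈-filter⁻ (¬? ∘ Q? j) {xs = xs} x∈ with cover x∈xs
    ... | _  , here refl , q = contradiction q ¬q
    ... | j′ , there j′∈ , q = j′ , j′∈ , q

    conclude : ∃[ j′ ] (j′ List.∈ js × length rest ≤ m * count (Q? j′) rest) →
               ∃[ j′ ] (j′ List.∈ j ∷ js × length xs ≤ length (j ∷ js) * count (Q? j′) xs)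
    conclude (j′ , j′∈ , le) = j′ , there j′∈ , (begin
      length xs       ≡⟨ count-∁ (Q? j) xs ⟨
      c + length rest ≤⟨ +-mono-≤ (<⇒≤ c<c′) rest≤ ⟩
      c′ + m * c′     ∎)
      where
      open ≤-Reasoning
      c′ = count (Q? j′) xs
      rest≤ : length rest ≤ m * c′
      rest≤ = ≤-trans le (*-monoʳ-≤ m (count-filter (Q? j′) (¬? ∘ Q? j) xs))
      c<c′ : c < c′
      c<c′ = *-cancelˡ-< m c c′ (<-≤-trans mc<rest rest≤)

  -- A union bound for classes of size at most `M / a`, multiplied through by `a` to avoid division.
  -- It suffices to bound the class that the pigeonhole principle provides.
  cover-bound : ∀ js xs a M → (∀ {x} → x List.∈ xs → ∃[ j ] (j List.∈ js × Q j x)) →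
                (∀ {j} → j List.∈ js → a * count (Q? j) xs ≤ M) → a * length xs ≤ length js * M
  cover-bound js [] a M cover bound = ≤-trans (≤-reflexive (*-zeroʳ a)) z≤n
  cover-bound js xs@(_ ∷ _) a M cover bound with j , j∈ , le ← pigeonhole js xs (s≤s z≤n) cover = begin
    a * length xs                         ≤⟨ *-monoʳ-≤ a le ⟩
    a * (length js * count (Q? j) xs)     ≡⟨ *-swap a (length js) _ ⟩
    length js * (a * count (Q? j) xs)     ≤⟨ *-monoʳ-≤ (length js) (bound j∈) ⟩
    length js * M                         ∎
    where
    open ≤-Reasoning
    *-swap : ∀ a b c → a * (b * c) ≡ b * (a * c)
    *-swap = solve-∀

-- Ramsey's theorem and greedy choice of independent sets

module _ {V : Pred A 0ℓ} {D R : Rel A 0ℓ} (R? : Decidable₂ R) (x : ℕ) (1≤x : 1 ≤ x)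
         (no-clique : ∀ {ys} → length ys ≡ x → All V ys → ¬ AllPairs R ys) where

  Independent : ℕ → List A → Set
  Independent t xs = ∃[ ys ] (length ys ≡ t × All (List._∈ xs) ys × AllPairs (λ u v → D u v × ¬ R u v) ys)

  Clique : ℕ → List A → Set
  Clique k xs = ∃[ ys ] (length ys ≡ k × All (List._∈ xs) ys × AllPairs R ys)

  -- Mutual induction with `independent-or-clique`, used at `k = x`, where `no-clique` excludes the
  -- second alternative. The relation `D` is merely carried along; it records distinctness or
  -- disjointness in the applications.
  ramsey : ∀ t {xs} → All V xs → AllPairs D xs → x ^ t ≤ length xs → Independent t xs

  -- A clique is grown one vertex at a time. If the head has `x ^ t` later non-neighbours, it
  -- extends an independent set found among them; otherwise passing to its neighbours loses few
  -- vertices and lowers `k` by one.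
  independent-or-clique : ∀ t k {xs} → All V xs → AllPairs D xs → k * x ^ t ≤ length xs →
                          Independent (suc t) xs ⊎ Clique k xs
  independent-or-clique t zero _ _ _ = inj₂ ([] , refl , [] , [])
  independent-or-clique t (suc k) {[]} _ _ le =
    contradiction (≤-trans (≤-trans (m^n>0 x {{>-nonZero 1≤x}} t) (m≤m+n _ _)) le) λ ()
  independent-or-clique t (suc k) {v ∷ xs} (Vv ∷ V-xs) (Dv ∷ D-xs) le
    with x ^ t ≤? count (¬? ∘ R? v) xs
  ... | yes many with ys , len , ys⊆ , ind ← ramsey t (All.filter⁺ (¬? ∘ R? v) V-xs)
                                               (AllPairs.filter⁺ (¬? ∘ R? v) D-xs) many =
    inj₁ ( v ∷ ys , cong suc len
         , here refl ∷ All.map (there ∘ proj₁ ∘ ∈-filter⁻ (¬? ∘ R? v) {xs = xs}) ys⊆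
         , All.map (λ y∈ → let y∈xs , ¬r = ∈-filter⁻ (¬? ∘ R? v) {xs = xs} y∈ in
                           All.lookup Dv y∈xs , ¬r) ys⊆ ∷ ind)
  ... | no few = case independent-or-clique t k (All.filter⁺ (R? v) V-xs)
                        (AllPairs.filter⁺ (R? v) D-xs) k≤ of λ where
      (inj₁ (ys , len , ys⊆ , ind)) →
        inj₁ (ys , len , All.map (there ∘ proj₁ ∘ ∈-filter⁻ (R? v) {xs = xs}) ys⊆ , ind)
      (inj₂ (ys , len , ys⊆ , cl)) →
        inj₂ ( v ∷ ys , cong suc len
             , here refl ∷ All.map (there ∘ proj₁ ∘ ∈-filter⁻ (R? v) {xs = xs}) ys⊆
             , All.map (proj₂ ∘ ∈-filter⁻ (R? v) {xs = xs}) ys⊆ ∷ cl)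
    where
    open ≤-Reasoning
    k≤ : k * x ^ t ≤ count (R? v) xs
    -- The non-neighbours are strictly fewer than `x ^ t`, so this loss also accounts for the head
    -- itself.
    k≤ = +-cancelʳ-≤ (x ^ t) _ _ (begin
      k * x ^ t + x ^ t                              ≡⟨ +-comm (k * x ^ t) _ ⟩
      x ^ t + k * x ^ t                              ≤⟨ le ⟩
      suc (length xs)                                ≡⟨ cong suc (count-∁ (R? v) xs) ⟨
      suc (count (R? v) xs + count (¬? ∘ R? v) xs)   ≡⟨ +-suc _ _ ⟨
      count (R? v) xs + suc (count (¬? ∘ R? v) xs)   ≤⟨ +-monoʳ-≤ (count (R? v) xs) (≰⇒> few) ⟩
      count (R? v) xs + x ^ t                        ∎)

  ramsey zero _ _ _ = [] , refl , [] , []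
  ramsey (suc t) V-xs D-xs le with independent-or-clique t x V-xs D-xs le
  ... | inj₁ ind = ind
  ... | inj₂ (ys , len , ys⊆ , cl) =
    contradiction cl (no-clique len (All.map (All.lookup V-xs) ys⊆))

-- A degree bound passes to induced subgraphs, so vertices can be picked greedily.
module _ {D R : Rel A 0ℓ} (R? : Decidable₂ R) (a M : ℕ) (1≤M : 1 ≤ M) where

  greedy-independent : ∀ t xs → AllPairs D xs → (∀ {v} → v List.∈ xs → a * suc (count (R? v) xs) ≤ M) →
    t * M ≤ a * length xs →
    ∃[ ys ] (length ys ≡ t × All (List._∈ xs) ys × AllPairs (λ u v → D u v × ¬ R u v) ys)
  greedy-independent zero xs _ _ _ = [] , refl , [] , []
  greedy-independent (suc t) [] _ _ le =
    contradiction (≤-trans (≤-trans 1≤M (m≤m+n M (t * M))) (≤-trans le (≤-reflexive (*-zeroʳ a)))) λ ()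
  greedy-independent (suc t) (v ∷ xs) (Dv ∷ D-xs) bound le
    = let ys , len , ys⊆ , ind = greedy-independent t rest (AllPairs.filter⁺ (¬? ∘ R? v) D-xs) bound′ le′ in
      v ∷ ys , cong suc len , here refl ∷ All.map (there ∘ proj₁ ∘ rest⁻) ys⊆
      , All.map (λ y∈ → All.lookup Dv (proj₁ (rest⁻ y∈)) , proj₂ (rest⁻ y∈)) ys⊆ ∷ ind
    where
    rest = filter (¬? ∘ R? v) xs
    rest⁻ : ∀ {y} → y List.∈ rest → y List.∈ xs × ¬ R v y
    rest⁻ = ∈-filter⁻ (¬? ∘ R? v) {xs = xs}
    open ≤-Reasoning
    count-tail : ∀ u → count (R? u) xs ≤ count (R? u) (v ∷ xs)
    count-tail u with R? u v
    ... | yes _ = n≤1+n _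
    ... | no _  = ≤-refl
    bound′ : ∀ {u} → u List.∈ rest → a * suc (count (R? u) rest) ≤ M
    bound′ {u} u∈ = ≤-trans
      (*-monoʳ-≤ a (s≤s (≤-trans (count-filter (R? u) (¬? ∘ R? v) xs) (count-tail u))))
      (bound (there (proj₁ (rest⁻ u∈))))
    le′ : t * M ≤ a * length rest
    -- Choosing `v` discards `v` and its neighbours, at most `M / a` entries; the `suc` in the
    -- degree bound stands for `v`.
    le′ = +-cancelˡ-≤ M _ _ (begin
      M + t * M                                      ≤⟨ le ⟩
      a * suc (length xs)                            ≡⟨ cong (λ l → a * suc l) (count-∁ (R? v) xs) ⟨
      a * (suc (count (R? v) xs) + length rest)      ≡⟨ *-distribˡ-+ a _ (length rest) ⟩
      a * suc (count (R? v) xs) + a * length rest    ≤⟨ +-monoˡ-≤ _ (*-monoʳ-≤ a (s≤s (count-tail v))) ⟩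
      a * suc (count (R? v) (v ∷ xs)) + a * length rest ≤⟨ +-monoˡ-≤ _ (bound (here refl)) ⟩
      M + a * length rest                            ∎)

-- `AllPairs` only relates earlier entries to later ones; symmetry extends this to any two distinct
-- indices.
AllPairs-lookup : {S : Rel A 0ℓ} → Symmetric S → ∀ {t xs} → length xs ≡ t → AllPairs S xs →
                  Σ (Fin t → A) λ f → (∀ i → f i List.∈ xs) × (∀ {i j} → i ≢ j → S (f i) (f j))
AllPairs-lookup S-sym refl [] = (λ ()) , (λ ()) , λ { {()} }
AllPairs-lookup {A = A} {S} S-sym {xs = x ∷ xs} refl (Sx ∷ S-xs)
  with f , f∈ , f-S ← AllPairs-lookup S-sym refl S-xs = g , g∈ , g-S
  where
  g : Fin (suc (length xs)) → A
  g zero    = x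
  g (suc i) = f i
  g∈ : ∀ i → g i List.∈ x ∷ xs
  g∈ zero    = here refl
  g∈ (suc i) = there (f∈ i)
  g-S : ∀ {i j} → i ≢ j → S (g i) (g j)
  g-S {zero}  {zero}  i≢j = contradiction refl i≢j
  g-S {zero}  {suc j} _   = All.lookup Sx (f∈ j)
  g-S {suc i} {zero}  _   = S-sym (All.lookup Sx (f∈ i))
  g-S {suc i} {suc j} i≢j = f-S (i≢j ∘ cong suc)

-- Tuples and double counting

tuples : ∀ t → List A → List (Vec A t)
tuples zero    xs = [] ∷ []
tuples (suc t) xs = cartesianProductWith _∷_ xs (tuples t xs)

length-tuples : ∀ t (xs : List A) → length (tuples t xs) ≡ length xs ^ t
length-tuples zero    xs = refl
length-tuples (suc t) xs = trans (length-product xs (tuples t xs)) (cong (length xs *_) (length-tuples t xs))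
  where
  length-product : ∀ (as : List A) (bs : List (Vec A t)) →
                   length (cartesianProductWith (_∷_) as bs) ≡ length as * length bs
  length-product []       bs = refl
  length-product (a ∷ as) bs = trans (length-++ (map (a ∷_) bs))
    (cong₂ _+_ (length-map (a ∷_) bs) (length-product as bs))

∈-tuples⁺ : ∀ {t} {xs : List A} (f : Fin t → A) → (∀ i → f i List.∈ xs) → tabulate f List.∈ tuples t xs
∈-tuples⁺ {t = zero}  f f∈ = here refl
∈-tuples⁺ {t = suc t} f f∈ = ∈-cartesianProductWith⁺ _∷_ (f∈ zero) (∈-tuples⁺ (f ∘ suc) (f∈ ∘ suc))

∈-tuples⁻ : ∀ {t} {xs : List A} {T : Vec A t} → T List.∈ tuples t xs → ∀ i → lookup T i List.∈ xs
∈-tuples⁻ {t = suc t} {xs} T∈ i with ∈-cartesianProductWith⁻ _∷_ xs (tuples t xs) T∈ | i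
... | _ , _ , a∈ , _ , refl  | zero  = a∈
... | _ , _ , _ , T′∈ , refl | suc i = ∈-tuples⁻ T′∈ i

module _ {R : REL A B 0ℓ} (R? : Decidable₂ R) where

  rich? : ∀ q bs → Decidable (λ y → q ≤ count (flip R? y) bs)
  rich? q bs y = q ≤? count (flip R? y) bs

  +-swap : ∀ a b c → a + (b + c) ≡ b + (a + c)
  +-swap = solve-∀

  double-count : ∀ bs ys y → sum (map (λ b → count (R? b) (y ∷ ys)) bs) ≡
                 count (flip R? y) bs + sum (map (λ b → count (R? b) ys) bs)
  double-count [] ys y = refl
  double-count (b ∷ bs) ys y with ih ← double-count bs ys y | R? b y
  ... | yes _ = cong suc (trans (cong (λ m → count (R? b) ys + m) ih) (+-swap (count (R? b) ys) (count (flip R? y) bs) _))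
  ... | no _  = trans (cong (λ m → count (R? b) ys + m) ih) (+-swap (count (R? b) ys) (count (flip R? y) bs) _)

  -- The pairs in `R` are counted from the side of `ys`: a rich entry contributes at most
  -- `length bs`, any other fewer than `q`.
  edges-upper : ∀ q bs ys → sum (map (λ b → count (R? b) ys) bs) ≤
                length bs * count (rich? q bs) ys + q * length ys
  edges-upper q bs [] = ≤-trans (≤-reflexive (zeros bs)) z≤n
    where
    zeros : ∀ bs → sum (map (λ b → count (R? b) []) bs) ≡ 0
    zeros []       = refl
    zeros (_ ∷ bs) = zeros bs
  edges-upper q bs (y ∷ ys) = step (rich? q bs y)
    where
    open ≤-Reasoning
    l = length bs
    r = count (rich? q bs) ys
    d = count (flip R? y) bs
    ih = edges-upper q bs ys
    expand₁ : ∀ l r q y → l + (l * r + q * y) ≡ l * (1 + r) + q * y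
    expand₁ = solve-∀
    expand₂ : ∀ l r q y → q + (l * r + q * y) ≡ l * r + q * (1 + y)
    expand₂ = solve-∀
    step : Dec (q ≤ d) → _ ≤ l * count (rich? q bs) (y ∷ ys) + q * suc (length ys)
    step (yes rich) = begin
      sum (map (λ b → count (R? b) (y ∷ ys)) bs)     ≡⟨ double-count bs ys y ⟩
      d + _                                          ≤⟨ +-mono-≤ (length-filter (flip R? y) bs) ih ⟩
      l + (l * r + q * length ys)                    ≡⟨ expand₁ l r q (length ys) ⟩
      l * suc r + q * length ys                      ≤⟨ +-monoʳ-≤ (l * suc r) (*-monoʳ-≤ q (n≤1+n _)) ⟩
      l * suc r + q * suc (length ys)                ≡⟨ cong (λ ys′ → l * length ys′ + q * suc (length ys)) (filter-accept (rich? q bs) rich) ⟨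
      l * count (rich? q bs) (y ∷ ys) + q * suc (length ys) ∎
    step (no poor) = begin
      sum (map (λ b → count (R? b) (y ∷ ys)) bs)     ≡⟨ double-count bs ys y ⟩
      d + _                                          ≤⟨ +-mono-≤ (<⇒≤ (≰⇒> poor)) ih ⟩
      q + (l * r + q * length ys)                    ≡⟨ expand₂ l r q (length ys) ⟩
      l * r + q * suc (length ys)                    ≡⟨ cong (λ ys′ → l * length ys′ + q * suc (length ys)) (filter-reject (rich? q bs) poor) ⟨
      l * count (rich? q bs) (y ∷ ys) + q * suc (length ys) ∎

  edges-lower : ∀ c M bs ys → (∀ {b} → b List.∈ bs → M ≤ c * count (R? b) ys) →
                length bs * M ≤ c * sum (map (λ b → count (R? b) ys) bs)
  edges-lower c M [] ys deg = z≤n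
  edges-lower c M (b ∷ bs) ys deg = begin
    M + length bs * M                       ≤⟨ +-mono-≤ (deg (here refl)) (edges-lower c M bs ys (deg ∘ there)) ⟩
    c * count (R? b) ys + c * _             ≡⟨ *-distribˡ-+ c (count (R? b) ys) _ ⟨
    c * (count (R? b) ys + _)               ∎
    where open ≤-Reasoning

  -- The length `2 * c * q` makes the number of pairs at least twice `q * length ys`. Entries that
  -- are not rich account for at most half of this, so the rich ones, with at most `2 * c * q` pairs
  -- each, account for the rest.
  many-rich : ∀ c q bs ys → 1 ≤ c → 1 ≤ q → length bs ≡ 2 * c * q →
              (∀ {b} → b List.∈ bs → length ys ≤ c * count (R? b) ys) →
              length ys ≤ 2 * c * count (rich? q bs) ys
  many-rich c q bs ys 1≤c 1≤q len deg =
    *-cancelˡ-≤ (c * q) {{>-nonZero (*-mono-≤ 1≤c 1≤q)}} (+-cancelˡ-≤ (c * q * Y) _ _ (begin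
      c * q * Y + c * q * Y                          ≡⟨ expand₁ c q Y ⟩
      2 * c * q * Y                                  ≡⟨ cong (_* Y) len ⟨
      length bs * Y                                  ≤⟨ edges-lower c Y bs ys deg ⟩
      c * sum (map (λ b → count (R? b) ys) bs)       ≤⟨ *-monoʳ-≤ c (edges-upper q bs ys) ⟩
      c * (length bs * r + q * Y)                    ≡⟨ cong (λ l → c * (l * r + q * Y)) len ⟩
      c * (2 * c * q * r + q * Y)                    ≡⟨ expand₂ c q r Y ⟩
      c * q * Y + c * q * (2 * c * r)                ∎))
    where
    open ≤-Reasoning
    Y = length ys
    r = count (rich? q bs) ys
    expand₁ : ∀ c q Y → c * q * Y + c * q * Y ≡ 2 * c * q * Y
    expand₁ = solve-∀
    expand₂ : ∀ c q r Y → c * (2 * c * q * r + q * Y) ≡ c * q * Y + c * q * (2 * c * r)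
    expand₂ = solve-∀

  -- Each y with at least q neighbours in bs sees a good tuple there, and there are only
  -- |bs|^t tuples, so one of them is seen by many y.
  common-neighbours : ∀ t {S : Pred (Vec A t) 0ℓ} → Decidable S → ∀ c q bs ys →
    1 ≤ c → 1 ≤ q → length bs ≡ 2 * c * q → 1 ≤ length ys →
    (∀ {b} → b List.∈ bs → length ys ≤ c * count (R? b) ys) →
    (∀ y → q ≤ count (flip R? y) bs →
       ∃[ f ] ((∀ i → f i List.∈ filter (flip R? y) bs) × S (tabulate f))) →
    ∃[ T ] ((∀ i → lookup T i List.∈ bs) × S T ×
            length ys ≤ 2 * c * (2 * c * q) ^ t * count (λ y → all? λ i → R? (lookup T i) y) ys)
  common-neighbours t {S} S? c q bs ys 1≤c 1≤q len 1≤ys deg good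
    = let T , T∈ , le = pigeonhole All? Ts rich 1≤rich cover in
      T , ∈-tuples⁻ (proj₁ (∈-filter⁻ S? {xs = tuples t bs} T∈)) , proj₂ (∈-filter⁻ S? {xs = tuples t bs} T∈) , (begin
      length ys                                        ≤⟨ rich≥ ⟩
      2 * c * length rich                              ≤⟨ *-monoʳ-≤ (2 * c) le ⟩
      2 * c * (length Ts * count (All? T) rich)        ≤⟨ *-monoʳ-≤ (2 * c) (*-mono-≤ Ts≤ (count-filter (All? T) (rich? q bs) ys)) ⟩
      2 * c * ((2 * c * q) ^ t * count (All? T) ys)    ≡⟨ *-assoc (2 * c) ((2 * c * q) ^ t) _ ⟨
      2 * c * (2 * c * q) ^ t * count (All? T) ys      ∎)
    where
    open ≤-Reasoning
    All? : Decidable₂ (λ T y → ∀ i → R (lookup T i) y)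
    All? T y = all? λ i → R? (lookup T i) y
    -- Only tuples satisfying `S` enter the pigeonhole, so the one it returns satisfies `S`.
    Ts = filter S? (tuples t bs)
    rich = filter (rich? q bs) ys
    rich≥ : length ys ≤ 2 * c * length rich
    rich≥ = many-rich c q bs ys 1≤c 1≤q len deg
    1≤rich : 1 ≤ length rich
    1≤rich = positive-factor (2 * c) 1≤ys rich≥
    Ts≤ : length Ts ≤ (2 * c * q) ^ t
    Ts≤ = ≤-trans (length-filter S? (tuples t bs))
            (≤-reflexive (trans (length-tuples t bs) (cong (_^ t) len)))
    cover : ∀ {y} → y List.∈ rich → ∃[ T ] (T List.∈ Ts × (∀ i → R (lookup T i) y))
    cover {y} y∈ with f , f∈ , Sf ← good y (proj₂ (∈-filter⁻ (rich? q bs) {xs = ys} y∈)) =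
      tabulate f
      , ∈-filter⁺ S? (∈-tuples⁺ f (proj₁ ∘ ∈-filter⁻ (flip R? y) {xs = bs} ∘ f∈)) Sf
      , λ i → subst (λ b → R b y) (sym (lookup∘tabulate f i)) (proj₂ (∈-filter⁻ (flip R? y) {xs = bs} (f∈ i)))

-- Induced minor models

x∈p─q⇒x∉q : ∀ {n x} (p q : Subset n) → x ∈ p ─ q → x ∉ q
x∈p─q⇒x∉q (inside ∷ p)  (outside ∷ q) here ()
x∈p─q⇒x∉q (_ ∷ p) (outside ∷ q) (there x∈p─q) (there x∈q) = x∈p─q⇒x∉q p q x∈p─q x∈q
x∈p─q⇒x∉q (_ ∷ p) (inside ∷ q)  (there x∈p─q) (there x∈q) = x∈p─q⇒x∉q p q x∈p─q x∈q

x∈p-y⇒x≢y : ∀ {n x y} (p : Subset n) → x ∈ p - y → x ≢ y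
x∈p-y⇒x≢y {x = x} p x∈p-y refl = x∈p─q⇒x∉q p ⁅ x ⁆ x∈p-y (x∈⁅x⁆ x)

Vertex-≡ : ∀ {n} {G : Graph n} {u v : Vertex G} → proj₁ u ≡ proj₁ v → u ≡ v
Vertex-≡ refl = cong (_ ,_) ([]=-irrelevant _ _)

-- The label classes of Fin n are the branch sets.  The labelling stays fixed while
-- unlabelled vertices are deleted and edges inside a class are contracted.
module BranchSets {m n} (H : Graph m) (full : ∀ i → i ∈ V H) (label : Fin n → Maybe (Fin m)) where
  open Graph H using () renaming (_~_ to _~ᴴ_; ~-irrefl to ~ᴴ-irrefl)

  -- The label is constant along a walk of such edges, so `Star` of this relation expresses
  -- connectedness inside one branch set.
  SameClass : Graph n → Fin n → Fin n → Set
  SameClass G a b = Graph._~_ G a b × label a ≡ label b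

  record IsModel (G : Graph n) : Set where
    open Graph G hiding (V)
    field
      onto      : ∀ i → ∃[ v ] (v ∈ V G × label v ≡ just i)
      connected : ∀ {i u v} → u ∈ V G → v ∈ V G → label u ≡ just i → label v ≡ just i →
                  Star (SameClass G) u v
      edge⁺     : ∀ {i j} → i ~ᴴ j → ∃[ u ] ∃[ v ] (u ~ v × label u ≡ just i × label v ≡ just j)
      edge⁻     : ∀ {i j u v} → u ~ v → label u ≡ just i → label v ≡ just j → i ≢ j → i ~ᴴ j

  open IsModel

  delete-unlabelled : ∀ {G v} → label v ≡ nothing → IsModel G → IsModel (G ∖ ⁅ v ⁆)
  delete-unlabelled {G} {v} v-none M = record
    { onto      = λ i → let w , w∈ , eq = onto M i in w , x∈p∧x≢y⇒x∈p-y w∈ (labelled eq) , eq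
    ; connected = λ u∈ w∈ eq eq′ → restrict eq (connected M (p─q⊆p _ _ u∈) (p─q⊆p _ _ w∈) eq eq′)
    ; edge⁺     = λ e → let a , b , ab , eq , eq′ = edge⁺ M e in
                        a , b , (ab , x≢y⇒x∉⁅y⁆ (labelled eq) , x≢y⇒x∉⁅y⁆ (labelled eq′)) , eq , eq′
    ; edge⁻     = λ (e , _) → edge⁻ M e
    }
    where
    labelled : ∀ {w i} → label w ≡ just i → w ≢ v
    labelled eq refl = case trans (sym eq) v-none of λ ()

    restrict : ∀ {i a b} → label a ≡ just i → Star (SameClass G) a b → Star (SameClass (G ∖ ⁅ v ⁆)) a b
    restrict eq ε = ε
    restrict eq ((e , same) ◅ p) =
      ((e , x≢y⇒x∉⁅y⁆ (labelled eq) , x≢y⇒x∉⁅y⁆ (labelled eq′)) , same) ◅ restrict eq′ p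
      where eq′ = trans (sym same) eq

  contract-class : ∀ {G u v} (uv : Graph._~_ G u v) → label u ≡ label v → IsModel G → IsModel (contract G uv)
  contract-class {G} {u} {v} uv same M = record
    { onto      = λ i → let w , w∈ , eq = onto M i in move w , move∈ w∈ , trans (label-move w) eq
    -- The surviving vertices are fixed by `move`, so the image under `move` of a walk in `G` has
    -- the required ends.
    ; connected = λ {_} {a} {b} a∈ b∈ eq eq′ →
        subst₂ (Star (SameClass G/uv)) (move-≢ (x∈p-y⇒x≢y (V G) a∈)) (move-≢ (x∈p-y⇒x≢y (V G) b∈))
          (Star.kleisliStar move step (connected M (p─q⊆p _ _ a∈) (p─q⊆p _ _ b∈) eq eq′))
    ; edge⁺     = λ {i} {j} e → let a , b , ab , eq , eq′ = edge⁺ M e in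
        move a , move b
        -- The edge is not collapsed: its ends have labels adjacent in `H`, hence distinct, and
        -- `move` preserves labels.
        , move-edge ab (λ a≡b → ~ᴴ-irrefl (subst (i ~ᴴ_) (sym (Maybe.just-injective (begin
            just i         ≡⟨ eq ⟨
            label a        ≡⟨ label-move a ⟨
            label (move a) ≡⟨ cong label a≡b ⟩
            label (move b) ≡⟨ label-move b ⟩
            label b        ≡⟨ eq′ ⟩
            just j         ∎))) e))
        , trans (label-move a) eq , trans (label-move b) eq′
    ; edge⁻     = λ where
        (_ , _ , _ , inj₁ e) eq eq′ → edge⁻ M e eq eq′
        (_ , _ , _ , inj₂ (inj₁ (refl , e))) eq eq′ → edge⁻ M e (trans (sym same) eq) eq′
        (_ , _ , _ , inj₂ (inj₂ (refl , e))) eq eq′ → edge⁻ M e eq (trans (sym same) eq′)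
    }
    where
    open Graph G using (_~_; ~-sym; ~⇒∈; ~-irrefl)
    open ≡-Reasoning
    G/uv = contract G uv
    open Graph G/uv using () renaming (_~_ to _~′_)

    u≢v : u ≢ v
    u≢v refl = ~-irrefl uv

    -- The quotient map of the contraction.
    move : Fin n → Fin n
    move w with w ≟ v
    ... | yes _ = u
    ... | no _  = w

    move-≢ : ∀ {w} → w ≢ v → move w ≡ w
    move-≢ {w} w≢v with w ≟ v
    ... | yes w≡v = contradiction w≡v w≢v
    ... | no _    = refl

    move∈ : ∀ {w} → w ∈ V G → move w ∈ V G - v
    move∈ {w} w∈ with w ≟ v
    ... | yes _  = x∈p∧x≢y⇒x∈p-y (~⇒∈ uv) u≢v
    ... | no w≢v = x∈p∧x≢y⇒x∈p-y w∈ w≢v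

    label-move : ∀ w → label (move w) ≡ label w
    label-move w with w ≟ v
    ... | yes refl = same
    ... | no _     = refl

    move-edge : ∀ {a b} → a ~ b → move a ≢ move b → move a ~′ move b
    move-edge {a} {b} ab ne with a ≟ v | b ≟ v
    ... | yes refl | yes refl = contradiction refl ne
    ... | yes refl | no b≢v   = u≢v , b≢v , ne , inj₂ (inj₁ (refl , ab))
    ... | no a≢v   | yes refl = a≢v , u≢v , ne , inj₂ (inj₂ (refl , ab))
    ... | no a≢v   | no b≢v   = a≢v , b≢v , ne , inj₁ ab

    step : ∀ {a b} → SameClass G a b → Star (SameClass G/uv) (move a) (move b)
    step {a} {b} (ab , eq) with move a ≟ move b
    ... | yes a≡b = subst (Star _ _) a≡b ε
    ... | no a≢b  = (move-edge ab a≢b , trans (label-move a) (trans eq (sym (label-move b)))) ◅ ε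

  -- A connected class without internal edges is a single vertex, so the labelling becomes a
  -- bijection onto the vertices of `H`.
  singletons⇒≅ : ∀ {G} → (∀ v → v ∈ V G → label v ≢ nothing) → (∀ {u v} → ¬ SameClass G u v) →
                 IsModel G → H ≅ G
  singletons⇒≅ {G} labelled no-edge M = record
    { bijection = mk↔ₛ′ to from to-from from-to
    ; adjacency = λ (i , _) (j , _) → mk⇔ (forth i j) (back i j)
    }
    where
    open Graph G hiding (V)
    value : ∀ v → v ∈ V G → ∃[ i ] label v ≡ just i
    value v v∈ with label v in eq
    ... | just i  = i , refl
    ... | nothing = contradiction eq (labelled v v∈)

    to : Vertex H → Vertex G
    to (i , _) = let v , v∈ , _ = onto M i in v , v∈

    from : Vertex G → Vertex H
    from (v , v∈) = proj₁ (value v v∈) , full _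

    unique : ∀ {i u v} → u ∈ V G → v ∈ V G → label u ≡ just i → label v ≡ just i → u ≡ v
    unique u∈ v∈ eq eq′ with connected M u∈ v∈ eq eq′
    ... | ε     = refl
    ... | s ◅ _ = contradiction s no-edge

    to-from : ∀ v → to (from v) ≡ v
    to-from (v , v∈) = let i , eq = value v v∈ ; w , w∈ , eq′ = onto M i in
      Vertex-≡ {G = G} (unique w∈ v∈ eq′ eq)

    from-to : ∀ i → from (to i) ≡ i
    from-to (i , _) = let v , v∈ , eq = onto M i ; j , eq′ = value v v∈ in
      Vertex-≡ {G = H} (Maybe.just-injective (trans (sym eq′) eq))

    forth : ∀ i j → i ~ᴴ j → proj₁ (onto M i) ~ proj₁ (onto M j)
    forth i j e =
      let a , b , ab , eq , eq′ = edge⁺ M e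
          u , u∈ , eqᵤ = onto M i
          v , v∈ , eqᵥ = onto M j
      in subst₂ _~_ (unique (~⇒∈ ab) u∈ eq eqᵤ) (unique (~⇒∈ (~-sym ab)) v∈ eq′ eqᵥ) ab

    back : ∀ i j → proj₁ (onto M i) ~ proj₁ (onto M j) → i ~ᴴ j
    back i j e =
      let _ , _ , eqᵤ = onto M i
          _ , _ , eqᵥ = onto M j
      in edge⁻ M e eqᵤ eqᵥ λ i≡j → no-edge (e , trans eqᵤ (trans (cong just i≡j) (sym eqᵥ)))

  -- Each deletion or contraction removes a vertex, which gives termination. Unlabelled vertices go
  -- first, so an edge contracted later has both ends in one branch set.
  model⇒≼ : ∀ G → Acc _<_ ∣ V G ∣ → IsModel G → H ≼ G
  model⇒≼ G (acc rec) M with any? (λ v → (v ∈? V G) ×-dec Maybe.≡-dec _≟_ (label v) nothing)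
  ... | yes (v , v∈ , none) = del v∈ (model⇒≼ _ (rec (x∈p⇒∣p-x∣<∣p∣ v∈)) (delete-unlabelled none M))
  ... | no labelled with any? (λ u → any? λ v → (Graph._~?_ G u v) ×-dec Maybe.≡-dec _≟_ (label u) (label v))
  ...   | yes (u , v , uv , same) = cont uv (model⇒≼ _ (rec (x∈p⇒∣p-x∣<∣p∣ (~⇒∈ (~-sym uv)))) (contract-class uv same M))
    where open Graph G using (~⇒∈; ~-sym)
  ...   | no no-edge = iso (singletons⇒≅ (λ v v∈ none → labelled (v , v∈ , none)) (λ s → no-edge (_ , _ , s)) M)

-- Cardinalities of subsets as list lengths

module _ {n} {P : Pred (Fin n) 0ℓ} (P? : Decidable P) where

  ∈-tabulate⁺ : ∀ {v} → P v → v ∈ tabulate (does ∘ P?)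
  ∈-tabulate⁺ {v} p = lookup⇒[]= v _ (trans (lookup∘tabulate (does ∘ P?) v) (dec-true (P? v) p))

  ∈-tabulate⁻ : ∀ {v} → v ∈ tabulate (does ∘ P?) → P v
  ∈-tabulate⁻ {v} v∈ with P? v | trans (sym (lookup∘tabulate (does ∘ P?) v)) ([]=⇒lookup v∈)
  ... | yes p | _ = p

∣p∪q∣≤∣p∣+∣q∣ : ∀ {n} (p q : Subset n) → ∣ p ∪ q ∣ ≤ ∣ p ∣ + ∣ q ∣
∣p∪q∣≤∣p∣+∣q∣ []            []            = z≤n
∣p∪q∣≤∣p∣+∣q∣ (outside ∷ p) (outside ∷ q) = ∣p∪q∣≤∣p∣+∣q∣ p q
∣p∪q∣≤∣p∣+∣q∣ (outside ∷ p) (inside ∷ q)  = ≤-trans (s≤s (∣p∪q∣≤∣p∣+∣q∣ p q)) (≤-reflexive (sym (+-suc _ _)))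
∣p∪q∣≤∣p∣+∣q∣ (inside ∷ p)  (outside ∷ q) = s≤s (∣p∪q∣≤∣p∣+∣q∣ p q)
∣p∪q∣≤∣p∣+∣q∣ (inside ∷ p)  (inside ∷ q)  = s≤s (≤-trans (∣p∪q∣≤∣p∣+∣q∣ p q) (+-monoʳ-≤ ∣ p ∣ (n≤1+n _)))

unique⇒length≤ : ∀ {n xs} {p : Subset n} → Unique xs → All (_∈ p) xs → length xs ≤ ∣ p ∣
unique⇒length≤ [] [] = z≤n
unique⇒length≤ (x∉xs ∷ xs!) (x∈p ∷ xs⊆p) = ≤-trans
  (s≤s (unique⇒length≤ xs! (All.zipWith (λ (x≢y , y∈p) → x∈p∧x≢y⇒x∈p-y y∈p (x≢y ∘ sym)) (x∉xs , xs⊆p))))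
  (x∈p⇒∣p-x∣<∣p∣ x∈p)

covers⇒length≥ : ∀ {n} (xs : List (Fin n)) {p : Subset n} → (∀ {v} → v ∈ p → v List.∈ xs) → ∣ p ∣ ≤ length xs
covers⇒length≥ {n} [] {p} cover = ≤-trans (p⊆q⇒∣p∣≤∣q∣ {q = ⊥} (λ v∈ → case cover v∈ of λ ())) (≤-reflexive (∣⊥∣≡0 n))
covers⇒length≥ (x ∷ xs) {p} cover = begin
  ∣ p ∣                    ≤⟨ p⊆q⇒∣p∣≤∣q∣ split ⟩
  ∣ ⁅ x ⁆ ∪ (p - x) ∣      ≤⟨ ∣p∪q∣≤∣p∣+∣q∣ ⁅ x ⁆ (p - x) ⟩
  ∣ ⁅ x ⁆ ∣ + ∣ (p - x) ∣    ≤⟨ +-mono-≤ (≤-reflexive (∣⁅x⁆∣≡1 x)) (covers⇒length≥ xs cover′) ⟩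
  suc (length xs)          ∎
  where
  open ≤-Reasoning
  split : p ⊆ ⁅ x ⁆ ∪ (p - x)
  split {v} v∈ with v ≟ x
  ... | yes refl = x∈p∪q⁺ (inj₁ (x∈⁅x⁆ x))
  ... | no v≢x   = x∈p∪q⁺ (inj₂ (x∈p∧x≢y⇒x∈p-y v∈ v≢x))
  cover′ : ∀ {v} → v ∈ p - x → v List.∈ xs
  cover′ v∈ with cover (p─q⊆p p _ v∈)
  ... | here refl = contradiction refl (x∈p-y⇒x≢y p v∈)
  ... | there v∈xs = v∈xs

elements : ∀ {n} → Subset n → List (Fin n)
elements p = filter (_∈? p) (allFin _)

elements-unique : ∀ {n} (p : Subset n) → Unique (elements p)
elements-unique p = Unique.filter⁺ (_∈? p) (Unique.allFin⁺ _)

∈-elements⁺ : ∀ {n v} {p : Subset n} → v ∈ p → v List.∈ elements p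
∈-elements⁺ {v = v} {p} = ∈-filter⁺ (_∈? p) (∈-allFin v)

∈-elements⁻ : ∀ {n v} {p : Subset n} → v List.∈ elements p → v ∈ p
∈-elements⁻ {p = p} v∈ = proj₂ (∈-filter⁻ (_∈? p) {xs = allFin _} v∈)

length-elements : ∀ {n} (p : Subset n) → length (elements p) ≡ ∣ p ∣
length-elements p = ≤-antisym (unique⇒length≤ (elements-unique p) (All.tabulate ∈-elements⁻))
                              (covers⇒length≥ (elements p) ∈-elements⁺)

-- Passes from balls, which are subsets, to the list counts on which all the counting arguments
-- operate.
∣∩∣≡count : ∀ {n} {P : Pred (Fin n) 0ℓ} (P? : Decidable P) (p : Subset n) →
            ∣ tabulate (does ∘ P?) ∩ p ∣ ≡ count P? (elements p)
∣∩∣≡count P? p = ≤-antisym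
  (covers⇒length≥ _ λ v∈ → let v∈P , v∈p = x∈p∩q⁻ (tabulate (does ∘ P?)) p v∈ in
                           ∈-filter⁺ P? (∈-elements⁺ v∈p) (∈-tabulate⁻ P? v∈P))
  (unique⇒length≤ (Unique.filter⁺ P? (elements-unique p)) (All.tabulate λ v∈ →
    let v∈p , Pv = ∈-filter⁻ P? {xs = elements p} v∈ in x∈p∩q⁺ (∈-tabulate⁺ P? Pv , ∈-elements⁻ v∈p)))

∈-subsets : ∀ {n} (p : Subset n) → p List.∈ subsets n
∈-subsets []            = here refl
∈-subsets (inside ∷ p)  = ∈-++⁺ˡ (∈-map⁺ (inside ∷_) (∈-subsets p))
∈-subsets (outside ∷ p) = ∈-++⁺ʳ _ (∈-map⁺ (outside ∷_) (∈-subsets p))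

fromList : ∀ {n} → List (Fin n) → Subset n
fromList = ⋃ ∘ map ⁅_⁆

∈-fromList⁺ : ∀ {n v} {xs : List (Fin n)} → v List.∈ xs → v ∈ fromList xs
∈-fromList⁺ (here refl) = x∈p∪q⁺ (inj₁ (x∈⁅x⁆ _))
∈-fromList⁺ (there v∈)  = x∈p∪q⁺ (inj₂ (∈-fromList⁺ v∈))

∈-fromList⁻ : ∀ {n v} (xs : List (Fin n)) → v ∈ fromList xs → v List.∈ xs
∈-fromList⁻ [] v∈ = contradiction v∈ ∉⊥
∈-fromList⁻ (x ∷ xs) v∈ with x∈p∪q⁻ ⁅ x ⁆ _ v∈
... | inj₁ v∈x  = here (x∈⁅y⁆⇒x≡y x v∈x)
... | inj₂ v∈xs = there (∈-fromList⁻ xs v∈xs)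

AllPairs-∈ : ∀ {A : Set} {S : A → A → Set} → (∀ {u v} → S u v → S v u) → ∀ {xs} → AllPairs S xs →
             ∀ {u v} → u List.∈ xs → v List.∈ xs → u ≢ v → S u v
AllPairs-∈ S-sym (Sx ∷ _) (here refl) (here refl) u≢v = contradiction refl u≢v
AllPairs-∈ S-sym (Sx ∷ _) (here refl) (there v∈)  u≢v = All.lookup Sx v∈
AllPairs-∈ S-sym (Sx ∷ _) (there u∈)  (here refl) u≢v = S-sym (All.lookup Sx u∈)
AllPairs-∈ S-sym (_ ∷ S)  (there u∈)  (there v∈)  u≢v = AllPairs-∈ S-sym S u∈ v∈ u≢v

-- Cliques and models of `K t t`

module _ {n} (G : Graph n) where
  open Graph G hiding (V)

  -- Adjacency is irreflexive, so the list has no repetitions and has as many entries as its set,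
  -- which occurs in the enumeration behind `ω`.
  clique-length≤ω : ∀ {ys} → All (_∈ V G) ys → AllPairs _~_ ys → length ys ≤ ω G
  clique-length≤ω {ys} ys⊆V cl = ≤-trans
    (unique⇒length≤ (AllPairs.map (λ { e refl → ~-irrefl e }) cl) (All.tabulate ∈-fromList⁺))
    (v≤max⁺ 0 _ (inj₂ (Any.map ≤-reflexive
      (∈-map⁺ ∣_∣ (∈-filter⁺ (isClique? G) (∈-subsets (fromList ys)) is-clique)))))
    where
    is-clique : IsClique G (fromList ys)
    is-clique = (λ v∈ → All.lookup ys⊆V (∈-fromList⁻ ys v∈))
              , λ u v u∈ v∈ → AllPairs-∈ ~-sym cl (∈-fromList⁻ ys u∈) (∈-fromList⁻ ys v∈)

  -- A model of K t t whose branch sets on the first side are single vertices.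
  module _ {t k} (A : Fin t → Fin n) (Q : Fin t → Fin k → Fin n) (root : Fin t → Fin k)
    (A∈V     : ∀ i → A i ∈ V G)
    (Q∈V     : ∀ j p → Q j p ∈ V G)
    (A-indep : ∀ {i i′} → i ≢ i′ → A i ≢ A i′ × ¬ A i ~ A i′)
    (Q-indep : ∀ {j j′} → j ≢ j′ → ∀ p q → Q j p ≢ Q j′ q × ¬ Q j p ~ Q j′ q)
    (A≢Q     : ∀ i j p → A i ≢ Q j p)
    (A~Q     : ∀ i j → ∃[ p ] A i ~ Q j p)
    (Q-conn  : ∀ j p → Star (λ a b → a ~ b × (∃[ q ] Q j q ≡ a) × (∃[ q ] Q j q ≡ b)) (Q j p) (Q j (root j)))
    where

    Branch : Fin t ⊎ Fin t → Fin n → Set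
    Branch (inj₁ i) v = A i ≡ v
    Branch (inj₂ j) v = ∃[ p ] Q j p ≡ v

    branch : Fin n → Maybe (Fin t ⊎ Fin t)
    branch v with any? (λ i → A i ≟ v) | any? (λ j → any? λ p → Q j p ≟ v)
    ... | yes (i , _) | _           = just (inj₁ i)
    ... | no _        | yes (j , _) = just (inj₂ j)
    ... | no _        | no _        = nothing

    branch⁻ : ∀ {v} s → branch v ≡ just s → Branch s v
    branch⁻ {v} s eq with any? (λ i → A i ≟ v) | any? (λ j → any? λ p → Q j p ≟ v)
    branch⁻ _ refl | yes (_ , b) | _           = b
    branch⁻ _ refl | no _        | yes (_ , b) = b

    Branch-unique : ∀ {v} s s′ → Branch s v → Branch s′ v → s ≡ s′
    Branch-unique (inj₁ i) (inj₁ i′) refl eq with i ≟ i′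
    ... | yes i≡i′ = cong inj₁ i≡i′
    ... | no i≢i′  = contradiction (sym eq) (proj₁ (A-indep i≢i′))
    Branch-unique (inj₁ i) (inj₂ j) refl (p , eq) = contradiction (sym eq) (A≢Q i j p)
    Branch-unique (inj₂ j) (inj₁ i) (p , refl) eq = contradiction eq (A≢Q i j p)
    Branch-unique (inj₂ j) (inj₂ j′) (p , refl) (q , eq) with j ≟ j′
    ... | yes j≡j′ = cong inj₂ j≡j′
    ... | no j≢j′  = contradiction (sym eq) (proj₁ (Q-indep j≢j′ p q))

    -- `branch` reports the first branch set that its search meets; disjointness of the branch sets
    -- makes it the only candidate.
    branch⁺ : ∀ {v} s → Branch s v → branch v ≡ just s
    branch⁺ {v} s b with branch v in eq
    ... | just s′ = cong just (Branch-unique s′ s (branch⁻ s′ eq) b)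
    ... | nothing = contradiction eq (occupied s b)
      where
      occupied : ∀ s → Branch s v → branch v ≢ nothing
      occupied s b eq with any? (λ i → A i ≟ v) | any? (λ j → any? λ p → Q j p ≟ v)
      occupied (inj₁ i) b       _ | no ¬A | no _  = ¬A (i , b)
      occupied (inj₂ j) (p , b) _ | no _  | no ¬Q = ¬Q (j , p , b)

    label : Fin n → Maybe (Fin (t + t))
    label = Maybe.map (join t t) ∘ branch

    label⁺ : ∀ {v} l → Branch (splitAt t l) v → label v ≡ just l
    label⁺ l b = trans (cong (Maybe.map (join t t)) (branch⁺ (splitAt t l) b)) (cong just (join-splitAt t t l))

    label⁻ : ∀ {v} l → label v ≡ just l → Branch (splitAt t l) v
    label⁻ {v} l eq with branch v in eq′
    label⁻ {v} _ refl | just s = subst (λ s → Branch s v) (sym (splitAt-join t t s)) (branch⁻ s eq′)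

    Connected : Fin t ⊎ Fin t → Fin n → Fin n → Set
    Connected s = Star λ a b → a ~ b × Branch s a × Branch s b

    branch-inhabited : ∀ s → ∃[ v ] (v ∈ V G × Branch s v)
    branch-inhabited (inj₁ i) = A i , A∈V i , refl
    branch-inhabited (inj₂ j) = Q j (root j) , Q∈V j (root j) , root j , refl

    branch-connected : ∀ s {u v} → Branch s u → Branch s v → Connected s u v
    branch-connected (inj₁ i) refl refl = ε
    branch-connected (inj₂ j) (p , refl) (q , refl) =
      -- Any two positions are linked through the root.
      Q-conn j p ◅◅ Star.reverse (λ (e , a , b) → ~-sym e , b , a) (Q-conn j q)

    side : Fin t ⊎ Fin t → _
    side = [ const true , const false ]′

    side-edge : ∀ s s′ → side s ≢ side s′ → ∃[ u ] ∃[ v ] (u ~ v × Branch s u × Branch s′ v)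
    side-edge (inj₁ i) (inj₁ _) ne = contradiction refl ne
    side-edge (inj₁ i) (inj₂ j) ne = let p , e = A~Q i j in _ , _ , e , refl , p , refl
    side-edge (inj₂ j) (inj₁ i) ne = let p , e = A~Q i j in _ , _ , ~-sym e , (p , refl) , refl
    side-edge (inj₂ _) (inj₂ _) ne = contradiction refl ne

    edge-side : ∀ s s′ {u v} → u ~ v → Branch s u → Branch s′ v → s ≢ s′ → side s ≢ side s′
    edge-side (inj₁ i) (inj₁ i′) e refl refl ne _ = proj₂ (A-indep (ne ∘ cong inj₁)) e
    edge-side (inj₁ _) (inj₂ _) _ _ _ _ ()
    edge-side (inj₂ _) (inj₁ _) _ _ _ _ ()
    edge-side (inj₂ j) (inj₂ j′) e (p , refl) (q , refl) ne _ = proj₂ (Q-indep (ne ∘ cong inj₂) p q) e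

    K≼ : K t t ≼ G
    K≼ = model⇒≼ G (<-wellFounded _) record
      { onto      = λ l → let v , v∈ , b = branch-inhabited (splitAt t l) in v , v∈ , label⁺ l b
      ; connected = λ {l} _ _ eq eq′ → Star.map
          (λ (e , a , b) → e , trans (label⁺ l a) (sym (label⁺ l b)))
          (branch-connected (splitAt t l) (label⁻ l eq) (label⁻ l eq′))
      ; edge⁺     = λ {i} {j} ij → let u , v , e , a , b = side-edge (splitAt t i) (splitAt t j) ij in
                      u , v , e , label⁺ i a , label⁺ j b
      ; edge⁻     = λ {i} {j} e eq eq′ i≢j → edge-side (splitAt t i) (splitAt t j) e (label⁻ i eq) (label⁻ j eq′)
                      λ s≡s′ → i≢j (trans (sym (join-splitAt t t i)) (trans (cong (join t t) s≡s′) (join-splitAt t t j)))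
      }
      where open BranchSets (K t t) (λ _ → ∈⊤) label

-- Polynomial bounds

-- For x ≥ 2 constants and sums are absorbed into the exponent.
PolyBounded : (ℕ → ℕ) → Set
PolyBounded g = ∃[ e ] (∀ x → 2 ≤ x → g x ≤ x ^ e)

^-mono : ∀ {x a b} → 2 ≤ x → a ≤ b → x ^ a ≤ x ^ b
^-mono {suc x} _ = ^-monoʳ-≤ (suc x)

n≤2^n : ∀ n → n ≤ 2 ^ n
n≤2^n zero    = z≤n
n≤2^n (suc n) = ≤-trans (+-mono-≤ (m^n>0 2 n) (n≤2^n n)) (≤-reflexive (cong (λ m → 2 ^ n + m) (sym (+-identityʳ (2 ^ n)))))

constᵖ : ∀ c → PolyBounded (const c)
constᵖ c = c , λ x 2≤x → ≤-trans (n≤2^n c) (^-monoˡ-≤ c 2≤x)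

idᵖ : PolyBounded (λ x → x)
idᵖ = 1 , λ x _ → ≤-reflexive (sym (*-identityʳ x))

infixl 6 _+ᵖ_
infixl 7 _*ᵖ_
infixr 8 _^ᵖ_

_*ᵖ_ : ∀ {f g} → PolyBounded f → PolyBounded g → PolyBounded (λ x → f x * g x)
(a , f≤) *ᵖ (b , g≤) = a + b , λ x 2≤x →
  ≤-trans (*-mono-≤ (f≤ x 2≤x) (g≤ x 2≤x)) (≤-reflexive (sym (^-distribˡ-+-* x a b)))

_+ᵖ_ : ∀ {f g} → PolyBounded f → PolyBounded g → PolyBounded (λ x → f x + g x)
_+ᵖ_ {f} {g} (a , f≤) (b , g≤) = suc (a + b) , bound
  where
  bound : ∀ x → 2 ≤ x → f x + g x ≤ x ^ suc (a + b)
  bound x 2≤x = begin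
    f x + g x                    ≤⟨ +-mono-≤ (f≤ x 2≤x) (g≤ x 2≤x) ⟩
    x ^ a + x ^ b                ≤⟨ +-mono-≤ (^-mono 2≤x (m≤m+n a b)) (^-mono 2≤x (m≤n+m b a)) ⟩
    x ^ (a + b) + x ^ (a + b)    ≡⟨ cong (λ m → x ^ (a + b) + m) (+-identityʳ _) ⟨
    2 * x ^ (a + b)              ≤⟨ *-monoˡ-≤ (x ^ (a + b)) 2≤x ⟩
    x * x ^ (a + b)              ∎
    where open ≤-Reasoning

_^ᵖ_ : ∀ {f} → PolyBounded f → ∀ n → PolyBounded (λ x → f x ^ n)
(a , f≤) ^ᵖ n = a * n , λ x 2≤x → ≤-trans (^-monoˡ-≤ n (f≤ x 2≤x)) (≤-reflexive (^-*-assoc x a n))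

lookup∘tabulate⁺₂ : ∀ {A : Set} {t} (S : A → A → Set) (f : Fin t → A) {i j} → S (f i) (f j) →
                 S (lookup (tabulate f) i) (lookup (tabulate f) j)
lookup∘tabulate⁺₂ S f {i} {j} = subst₂ S (sym (lookup∘tabulate f i)) (sym (lookup∘tabulate f j))

-- Separating disjoint bags

module Separation (t k : ℕ) (1≤t : 1 ≤ t) (1≤k : 1 ≤ k) where

  pairs : List (Fin k × Fin k)
  pairs = cartesianProduct (allFin k) (allFin k)

  -- A heavy bag touches a fraction `1 / (4 * t)` of the bags, hence a fraction `1 / density` of
  -- them at one fixed pair of positions.
  density : ℕ
  density = 4 * t * length pairs

  -- The length `2 * c * q` required by `common-neighbours`, for `c = density` and `q = x ^ t`.
  sample : ℕ → ℕ
  sample x = 2 * density * x ^ t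

  -- The first summand serves the greedy choice among light bags, the second yields `sample x` bags
  -- heavy at the same pair of positions, and the third leaves `x ^ t` common neighbours for
  -- Ramsey's theorem.
  threshold : ℕ → ℕ
  threshold x = 4 * t + 2 * length pairs * sample x + 2 * density * sample x ^ t * x ^ t

  thresholdᵖ : PolyBounded threshold
  thresholdᵖ = constᵖ (4 * t) +ᵖ constᵖ (2 * length pairs) *ᵖ sampleᵖ
                 +ᵖ constᵖ (2 * density) *ᵖ sampleᵖ ^ᵖ t *ᵖ idᵖ ^ᵖ t
    where
    sampleᵖ : PolyBounded sample
    sampleᵖ = constᵖ (2 * density) *ᵖ idᵖ ^ᵖ t

  ∈-pairs : ∀ p q → (p , q) List.∈ pairs
  ∈-pairs p q = ∈-cartesianProduct⁺ (∈-allFin p) (∈-allFin q)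

  1≤pairs : 1 ≤ length pairs
  1≤pairs = ∈-length (∈-pairs (fromℕ< 1≤k) (fromℕ< 1≤k))

  1≤density : 1 ≤ density
  1≤density = *-mono-≤ (*-mono-≤ (s≤s {n = 3} z≤n) 1≤t) 1≤pairs

  module _ {n} (G : Graph n) (x : ℕ) (1≤x : 1 ≤ x) (no-K : InducedMinorFree (K t t) G)
           (no-clique : ∀ {ys} → length ys ≡ x → All (_∈ V G) ys → ¬ AllPairs (Graph._~_ G) ys) where
    open Graph G hiding (V)

    module _ {I : Set} (P : I → Fin k → Fin n) (P∈V : ∀ y p → P y p ∈ V G) where

      Disjoint Touch : I → I → Set
      Disjoint y z = ∀ p q → P y p ≢ P z q
      Touch    y z = ∃[ p ] ∃[ q ] P y p ~ P z q

      TouchAt : Fin k × Fin k → I → I → Set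
      TouchAt (p , q) y z = P y p ~ P z q

      touchAt? : ∀ pq → Decidable₂ (TouchAt pq)
      touchAt? (p , q) y z = P y p ~? P z q

      touch? : Decidable₂ Touch
      touch? y z = any? λ p → any? λ q → P y p ~? P z q

      1≤q : 1 ≤ x ^ t
      1≤q = m^n>0 x {{>-nonZero 1≤x}} t

      -- Ramsey's theorem for the `p`-th vertices of the bags; disjointness of the bags makes these
      -- vertices distinct.
      stable-system : ∀ p zs → AllPairs Disjoint zs → x ^ t ≤ length zs →
        Σ (Fin t → I) λ f → (∀ i → f i List.∈ zs) ×
          (∀ {i j} → i ≢ j → P (f i) p ≢ P (f j) p × ¬ P (f i) p ~ P (f j) p)
      stable-system p zs disj len =
        let ys , len′ , ys⊆ , ind = ramsey {V = λ _ → ⊤} (touchAt? (p , p)) x 1≤x no-clique′ t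
                                       (All.universal (λ _ → tt) zs) disj len
            f , f∈ , f-ind = AllPairs-lookup {S = λ y z → P y p ≢ P z p × ¬ P y p ~ P z p}
               (λ (ne , na) → ne ∘ sym , na ∘ ~-sym) len′ (AllPairs.map (λ (d , na) → d p p , na) ind)
        in f , (λ i → All.lookup ys⊆ (f∈ i)) , f-ind
        where
        no-clique′ : ∀ {ys} → length ys ≡ x → All (λ _ → ⊤) ys → ¬ AllPairs (TouchAt (p , p)) ys
        no-clique′ {ys} len _ cl = no-clique (trans (length-map (λ y → P y p) ys) len)
          (All.map⁺ (All.universal (λ y → P∈V y p) ys)) (AllPairs.map⁺ cl)

      module _ (Z : List I) (Z-disj : AllPairs Disjoint Z) where

        Heavy : I → Set
        Heavy y = length Z ≤ 4 * t * count (touch? y) Z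

        heavy? : Decidable Heavy
        heavy? y = _ ≤? _

        HeavyAt : Fin k × Fin k → I → Set
        HeavyAt pq y = length Z ≤ density * count (touchAt? pq y) Z

        heavyAt? : Decidable₂ HeavyAt
        heavyAt? pq y = _ ≤? _

        heavy⇒heavyAt : 1 ≤ length Z → ∀ {y} → Heavy y → ∃[ pq ] (pq List.∈ pairs × HeavyAt pq y)
        heavy⇒heavyAt 1≤Z {y} heavy =
          let pq , pq∈ , le = pigeonhole (λ pq → touchAt? pq y) pairs (filter (touch? y) Z) 1≤touched
                 (λ z∈ → let p , q , e = proj₂ (∈-filter⁻ (touch? y) {xs = Z} z∈) in (p , q) , ∈-pairs p q , e)
          in pq , pq∈ , (begin
          length Z                                                   ≤⟨ heavy ⟩
          4 * t * count (touch? y) Z                                 ≤⟨ *-monoʳ-≤ (4 * t) le ⟩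
          4 * t * (length pairs * count (touchAt? pq y) (filter (touch? y) Z))
            ≤⟨ *-monoʳ-≤ (4 * t) (*-monoʳ-≤ (length pairs) (count-filter (touchAt? pq y) (touch? y) Z)) ⟩
          4 * t * (length pairs * count (touchAt? pq y) Z)           ≡⟨ *-assoc (4 * t) (length pairs) _ ⟨
          density * count (touchAt? pq y) Z                          ∎)
          where
          open ≤-Reasoning
          1≤touched : 1 ≤ count (touch? y) Z
          1≤touched = positive-factor (4 * t) 1≤Z heavy

        -- Many y whose p-th vertices are adjacent to a positive fraction of the q-th
        -- vertices yield an induced K t t between p-th and q-th vertices.
        heavyAt-few : ∀ p q → sample x ≤ count (heavyAt? (p , q)) Z →
                      1 ≤ length Z → ¬ 2 * density * sample x ^ t * x ^ t ≤ length Z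
        heavyAt-few p q many 1≤Z large = no-K
          (K≼ G (λ i → P (lookup T i) p) (λ j _ → P (f j) q) (λ _ → zero {0})
            (λ i → P∈V (lookup T i) p) (λ j _ → P∈V (f j) q)
            (λ {i} {j} → T-stable i j) (λ j≢j′ _ _ → f-stable j≢j′)
            -- The same bag may occur on both sides, but the chosen vertices are adjacent and
            -- therefore distinct.
            (λ i j _ eq → ~-irrefl (subst (P (lookup T i) p ~_) (sym eq) (joined i j)))
            (λ i j → zero , joined i j) (λ { j zero → ε }))
          where
          heavies = filter (heavyAt? (p , q)) Z
          bs = take (sample x) heavies

          R? : Decidable₂ (TouchAt (p , q))
          R? = touchAt? (p , q)

          Stable : Vec I t → Set
          Stable T = ∀ i j → i ≢ j → P (lookup T i) p ≢ P (lookup T j) p × ¬ P (lookup T i) p ~ P (lookup T j) p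

          stable? : Decidable Stable
          stable? T = all? λ i → all? λ j → ¬? (i ≟ j) →-dec
            (¬? (P (lookup T i) p ≟ P (lookup T j) p) ×-dec ¬? (P (lookup T i) p ~? P (lookup T j) p))

          bs-deg : ∀ {b} → b List.∈ bs → length Z ≤ density * count (R? b) Z
          bs-deg = All.lookup (All.take⁺ (sample x) (All.tabulate (proj₂ ∘ ∈-filter⁻ (heavyAt? (p , q)) {xs = Z})))

          bs-disj : AllPairs Disjoint bs
          bs-disj = AllPairs.take⁺ (sample x) (AllPairs.filter⁺ (heavyAt? (p , q)) Z-disj)

          find-stable : ∀ z → x ^ t ≤ count (flip R? z) bs →
                        ∃[ f ] ((∀ i → f i List.∈ filter (flip R? z) bs) × Stable (tabulate f))
          find-stable z rich =
            let f , f∈ , f-ind = stable-system p (filter (flip R? z) bs) (AllPairs.filter⁺ (flip R? z) bs-disj) rich in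
            f , f∈ , λ i j i≢j → lookup∘tabulate⁺₂ (λ y y′ → P y p ≢ P y′ p × ¬ P y p ~ P y′ p) f (f-ind i≢j)

          common : _
          common = common-neighbours R? t stable? density (x ^ t) bs Z 1≤density 1≤q
                     (trans (length-take (sample x) heavies) (m≤n⇒m⊓n≡m many)) 1≤Z bs-deg find-stable

          T = proj₁ common
          T-stable = proj₁ (proj₂ (proj₂ common))

          All? : Decidable (λ z → ∀ i → TouchAt (p , q) (lookup T i) z)
          All? z = all? λ i → R? (lookup T i) z

          factor = 2 * density * sample x ^ t

          1≤factor : 1 ≤ factor
          1≤factor = *-mono-≤ (*-mono-≤ (s≤s {n = 1} z≤n) 1≤density)
            (m^n>0 (sample x) {{>-nonZero (*-mono-≤ (*-mono-≤ (s≤s {n = 1} z≤n) 1≤density) 1≤q)}} t)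

          -- Dividing `large` by the loss `factor` leaves at least `x ^ t` common neighbours;
          -- Ramsey's theorem now provides the other side from their `q`-th vertices.
          second : _
          second = stable-system q (filter All? Z) (AllPairs.filter⁺ All? Z-disj)
            (*-cancelˡ-≤ factor {{>-nonZero 1≤factor}} (≤-trans large (proj₂ (proj₂ (proj₂ common)))))

          f = proj₁ second
          f-stable = proj₂ (proj₂ second)

          joined : ∀ i j → P (lookup T i) p ~ P (f j) q
          joined i j = proj₂ (∈-filter⁻ All? {xs = Z} (proj₁ (proj₂ second) j)) i

        -- If at least half of the bags are light, the touching relation among these is sparse
        -- enough for a greedy choice. Otherwise at least half are heavy, and some pair of positions
        -- is responsible for too many of them, against `heavyAt-few`.
        separate : threshold x ≤ length Z →
          Σ (Fin t → I) λ f → (∀ i → f i List.∈ Z) ×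
            (∀ {i j} → i ≢ j → ∀ p q → P (f i) p ≢ P (f j) q × ¬ P (f i) p ~ P (f j) q)
        separate large with length Z ≤? 2 * count (¬? ∘ heavy?) Z
        ... | yes mostly-light =
          let ys , len , ys⊆ , ind = greedy-independent touch? (2 * t) (length Z) 1≤Z t light
                 (AllPairs.filter⁺ (¬? ∘ heavy?) Z-disj) light-degree
                 (≤-trans (*-monoʳ-≤ t mostly-light) (≤-reflexive (swap t (length light))))
              f , f∈ , f-ind = AllPairs-lookup {S = λ y z → Disjoint y z × ¬ Touch y z}
                 (λ (d , na) → (λ p q → d q p ∘ sym) , λ (p , q , e) → na (q , p , ~-sym e)) len ind
          in f , (λ i → proj₁ (∈-filter⁻ (¬? ∘ heavy?) {xs = Z} (All.lookup ys⊆ (f∈ i))))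
            , λ i≢j p q → proj₁ (f-ind i≢j) p q , λ e → proj₂ (f-ind i≢j) (p , q , e)
          where
          light = filter (¬? ∘ heavy?) Z
          4t≤Z : 4 * t ≤ length Z
          4t≤Z = ≤-trans (≤-trans (m≤m+n _ _) (m≤m+n _ _)) large
          1≤Z : 1 ≤ length Z
          1≤Z = ≤-trans (*-mono-≤ (s≤s {n = 3} z≤n) 1≤t) 4t≤Z
          swap : ∀ t l → t * (2 * l) ≡ 2 * t * l
          swap = solve-∀
          -- After doubling, the bound splits into `4 * t` for the bag itself and `4 * t` times its
          -- degree, each at most `length Z`.
          light-degree : ∀ {y} → y List.∈ light → 2 * t * suc (count (touch? y) light) ≤ length Z
          light-degree {y} y∈ = *-cancelˡ-≤ 2 (begin
            2 * (2 * t * suc (count (touch? y) light))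
              ≤⟨ *-monoʳ-≤ 2 (*-monoʳ-≤ (2 * t) (s≤s (count-filter (touch? y) (¬? ∘ heavy?) Z))) ⟩
            2 * (2 * t * suc (count (touch? y) Z))     ≡⟨ expand t (count (touch? y) Z) ⟩
            4 * t + 4 * t * count (touch? y) Z
              ≤⟨ +-mono-≤ 4t≤Z (<⇒≤ (≰⇒> (proj₂ (∈-filter⁻ (¬? ∘ heavy?) {xs = Z} y∈)))) ⟩
            length Z + length Z                        ≡⟨ cong (λ m → length Z + m) (+-identityʳ _) ⟨
            2 * length Z                               ∎)
            where
            open ≤-Reasoning
            expand : ∀ t c → 2 * (2 * t * (1 + c)) ≡ 4 * t + 4 * t * c
            expand = solve-∀
        ... | no ¬mostly-light = contradiction (≤-trans (m≤n+m _ (4 * t + 2 * length pairs * sample x)) large)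
                                   (heavyAt-few (proj₁ (proj₁ found)) (proj₂ (proj₁ found)) many 1≤Z)
          where
          open ≤-Reasoning
          heavies = filter heavy? Z
          1≤Z : 1 ≤ length Z
          1≤Z = ≤-trans (*-mono-≤ (s≤s {n = 3} z≤n) 1≤t) (≤-trans (≤-trans (m≤m+n _ _) (m≤m+n _ _)) large)
          Z≤2heavies : length Z ≤ 2 * length heavies
          Z≤2heavies = +-cancelʳ-≤ (length Z) _ _ (begin
            length Z + length Z                                     ≡⟨ cong (λ m → length Z + m) (+-identityʳ _) ⟨
            2 * length Z                                            ≡⟨ cong (2 *_) (count-∁ heavy? Z) ⟨
            2 * (length heavies + count (¬? ∘ heavy?) Z)            ≡⟨ *-distribˡ-+ 2 (length heavies) _ ⟩
            2 * length heavies + 2 * count (¬? ∘ heavy?) Z          ≤⟨ +-monoʳ-≤ (2 * length heavies) (<⇒≤ (≰⇒> ¬mostly-light)) ⟩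
            2 * length heavies + length Z                           ∎)
          1≤heavies : 1 ≤ length heavies
          1≤heavies = positive-factor 2 1≤Z Z≤2heavies
          found : ∃[ pq ] (pq List.∈ pairs × length heavies ≤ length pairs * count (heavyAt? pq) heavies)
          found = pigeonhole heavyAt? pairs heavies 1≤heavies
                    λ y∈ → heavy⇒heavyAt 1≤Z (proj₂ (∈-filter⁻ heavy? {xs = Z} y∈))
          pq = proj₁ found
          many : sample x ≤ count (heavyAt? pq) Z
          many = *-cancelˡ-≤ (2 * length pairs) {{>-nonZero (*-mono-≤ (s≤s {n = 1} z≤n) 1≤pairs)}} (begin
            2 * length pairs * sample x                             ≤⟨ m≤n+m _ (4 * t) ⟩
            4 * t + 2 * length pairs * sample x                     ≤⟨ m≤m+n _ _ ⟩
            threshold x                                             ≤⟨ large ⟩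
            length Z                                                ≤⟨ Z≤2heavies ⟩
            2 * length heavies                                      ≤⟨ *-monoʳ-≤ 2 (proj₂ (proj₂ found)) ⟩
            2 * (length pairs * count (heavyAt? pq) heavies)        ≤⟨ *-monoʳ-≤ 2 (*-monoʳ-≤ (length pairs) (count-filter (heavyAt? pq) heavy? Z)) ⟩
            2 * (length pairs * count (heavyAt? pq) Z)              ≡⟨ *-assoc 2 (length pairs) _ ⟨
            2 * length pairs * count (heavyAt? pq) Z                ∎)

-- Sparse balls

count-map : ∀ {A B : Set} {P : Pred B 0ℓ} (P? : Decidable P) (f : A → B) xs →
            count (P? ∘ f) xs ≡ count P? (map f xs)
count-map P? f [] = refl
count-map P? f (x ∷ xs) with P? (f x)
... | yes _ = cong suc (count-map P? f xs)
... | no _  = count-map P? f xs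

map-proj₁-toList : ∀ {A : Set} {P : Pred A 0ℓ} {xs} (pxs : All P xs) → map proj₁ (All.toList pxs) ≡ xs
map-proj₁-toList []         = refl
map-proj₁-toList (px ∷ pxs) = cong (_ ∷_) (map-proj₁-toList pxs)

module _ {n} {H : Graph n} where
  open Graph H using (_~_; ~⇒∈)

  vertex : ∀ {k u v} → Walk H k u v → Fin (suc k) → Fin n
  vertex {u = u} _       zero    = u
  vertex         (_ ∷ p) (suc j) = vertex p j

  vertex∈V : ∀ {k u v} (p : Walk H k u v) j → vertex p j ∈ V H
  vertex∈V ([] v∈) zero    = v∈
  vertex∈V (e ∷ p) zero    = ~⇒∈ e
  vertex∈V (e ∷ p) (suc j) = vertex∈V p j

  vertex-last : ∀ {k u v} (p : Walk H k u v) → vertex p (fromℕ k) ≡ v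
  vertex-last ([] _)  = refl
  vertex-last (e ∷ p) = vertex-last p

  -- The rest of the walk is the witness. This places a whole bag inside the ball around the common
  -- end of its walks.
  vertex-dist : ∀ {k u v} (p : Walk H k u v) j → Dist≤ H k (vertex p j) v
  vertex-dist p       zero    = _ , ≤-refl , p
  vertex-dist (e ∷ p) (suc j) = let l , l≤k , q = vertex-dist p j in l , m≤n⇒m≤1+n l≤k , q

  vertex-connected : ∀ (Q : Fin n → Set) {k u v} (p : Walk H k u v) → (∀ j → Q (vertex p j)) →
                     ∀ j → Star (λ a b → a ~ b × Q a × Q b) (vertex p j) v
  vertex-connected Q ([] _)  Qp zero    = ε
  vertex-connected Q (e ∷ p) Qp zero    = (e , Qp zero , Qp (suc zero)) ◅ vertex-connected Q p (Qp ∘ suc) zero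
  vertex-connected Q (e ∷ p) Qp (suc j) = vertex-connected Q p (Qp ∘ suc) j

Walk-∖-antitone : ∀ {n} (G : Graph n) {X X′ k u v} → X ⊆ X′ → Walk (G ∖ X′) k u v → Walk (G ∖ X) k u v
Walk-∖-antitone G {X} {X′} X⊆X′ ([] v∈) =
  [] (x∈p∧x∉q⇒x∈p─q (p─q⊆p _ _ v∈) (x∈p─q⇒x∉q (V G) X′ v∈ ∘ X⊆X′))
Walk-∖-antitone G X⊆X′ ((e , u∉ , v∉) ∷ p) = (e , u∉ ∘ X⊆X′ , v∉ ∘ X⊆X′) ∷ Walk-∖-antitone G X⊆X′ p

∣ball∩∣≡count : ∀ {n} (H : Graph n) r v (Y : Subset n) →
                ∣ N[ r ] H v ∩ Y ∣ ≡ count (dist≤? H r v) (elements Y)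
∣ball∩∣≡count H r v Y = ∣∩∣≡count (dist≤? H r v) Y

-- The parameter `x` both bounds the clique number and is the reciprocal of the allowed fraction of
-- `Y`. The exponent `e` is uniform in `x`, so the statement can be applied at a power of `x`.
SparseBalls : ℕ → ℕ → Set₁
SparseBalls t r = ∃[ e ] (∀ x → 2 ≤ x → ∀ {n} (G : Graph n) → InducedMinorFree (K t t) G → ω G < x →
  ∀ Y → Y ⊆ V G → ∃[ X ] (X ⊆ V G × ∣ X ∣ ≤ x ^ e ×
    (∀ {v} → v ∈ V G ─ X → x * ∣ N[ r ] (G ∖ X) v ∩ Y ∣ ≤ ∣ Y ∣)))

-- A ball of radius 0 has at most one vertex, which is a small enough fraction of `Y` unless `Y` has
-- at most `x` elements; in that case all of `Y` is removed.
sparse-zero : ∀ t → SparseBalls t 0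
sparse-zero t = 1 , sparse
  where
  open ≤-Reasoning
  sparse : ∀ x → 2 ≤ x → ∀ {n} (G : Graph n) → InducedMinorFree (K t t) G → ω G < x →
    ∀ Y → Y ⊆ V G → ∃[ X ] (X ⊆ V G × ∣ X ∣ ≤ x ^ 1 ×
      (∀ {v} → v ∈ V G ─ X → x * ∣ N[ 0 ] (G ∖ X) v ∩ Y ∣ ≤ ∣ Y ∣))
  sparse x 2≤x {n} G _ _ Y Y⊆V with ∣ Y ∣ ≤? x
  ... | yes small = Y , Y⊆V , ≤-trans small (≤-reflexive (sym (*-identityʳ x))) , λ {v} _ → begin
      x * ∣ N[ 0 ] (G ∖ Y) v ∩ Y ∣ ≤⟨ *-monoʳ-≤ x (p⊆q⇒∣p∣≤∣q∣ {q = ⊥} (empty v)) ⟩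
      x * ∣ ⊥ {n} ∣                ≡⟨ cong (x *_) (∣⊥∣≡0 n) ⟩
      x * 0                        ≡⟨ *-zeroʳ x ⟩
      0                            ≤⟨ z≤n ⟩
      ∣ Y ∣                        ∎
    where
    empty : ∀ v → N[ 0 ] (G ∖ Y) v ∩ Y ⊆ ⊥
    empty v w∈ with w∈N , w∈Y ← x∈p∩q⁻ (N[ 0 ] (G ∖ Y) v) Y w∈
      with _ , z≤n , [] w∈V ← ∈-tabulate⁻ (dist≤? (G ∖ Y) 0 v) w∈N
      = contradiction w∈Y (x∈p─q⇒x∉q (V G) Y w∈V)
  ... | no large = ⊥ , (λ v∈ → contradiction v∈ ∉⊥) , ≤-trans (≤-reflexive (∣⊥∣≡0 n)) z≤n , λ {v} _ → begin
      x * ∣ N[ 0 ] (G ∖ ⊥) v ∩ Y ∣ ≤⟨ *-monoʳ-≤ x (covers⇒length≥ (v ∷ []) (singleton v)) ⟩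
      x * 1                        ≡⟨ *-identityʳ x ⟩
      x                            ≤⟨ <⇒≤ (≰⇒> large) ⟩
      ∣ Y ∣                        ∎
    where
    singleton : ∀ v {w} → w ∈ N[ 0 ] (G ∖ ⊥) v ∩ Y → w List.∈ v ∷ []
    singleton v w∈ with w∈N , _ ← x∈p∩q⁻ (N[ 0 ] (G ∖ ⊥) v) Y w∈
      with _ , z≤n , [] _ ← ∈-tabulate⁻ (dist≤? (G ∖ ⊥) 0 v) w∈N = here refl

-- The induction step on the radius

module Step (t r : ℕ) (1≤t : 1 ≤ t) where

  -- The number of positions in a bag: `t` walks with `suc r` vertices each, repetitions allowed.
  k : ℕ
  k = t * suc r

  1≤k : 1 ≤ k
  1≤k = *-mono-≤ 1≤t (s≤s {n = r} z≤n)

  open Separation t k 1≤t 1≤k using (threshold; thresholdᵖ; separate)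

  -- The number of bad vertices that leads to a contradiction.
  sample : ℕ → ℕ
  sample x = 2 * x * x ^ t

  -- t bad vertices have a common set of at least |Y| / loss x vertices within distance r + 1.
  loss : ℕ → ℕ
  loss x = 2 * x * sample x ^ t

  -- The parameter x at radius r + 1 requires the parameter scale x at radius r.
  scale : ℕ → ℕ
  scale x = x + 2 * t * loss x + 2 * threshold x * (k * (2 * loss x))

  sampleᵖ : PolyBounded sample
  sampleᵖ = constᵖ 2 *ᵖ idᵖ *ᵖ idᵖ ^ᵖ t

  scaleᵖ : PolyBounded scale
  scaleᵖ = idᵖ +ᵖ constᵖ (2 * t) *ᵖ lossᵖ +ᵖ constᵖ 2 *ᵖ thresholdᵖ *ᵖ (constᵖ k *ᵖ (constᵖ 2 *ᵖ lossᵖ))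
    where
    lossᵖ : PolyBounded loss
    lossᵖ = constᵖ 2 *ᵖ idᵖ *ᵖ sampleᵖ ^ᵖ t

  module _ {n} (G : Graph n) (x : ℕ) (2≤x : 2 ≤ x) (no-K : InducedMinorFree (K t t) G) (ω<x : ω G < x)
           (X : Subset n) (Y : Subset n) (x′ : ℕ) (scale≤x′ : scale x ≤ x′)
           (small-balls : ∀ {v} → v ∈ V (G ∖ X) → x′ * ∣ N[ r ] (G ∖ X) v ∩ Y ∣ ≤ ∣ Y ∣) where
    open Graph G hiding (V)

    H = G ∖ X
    ys = elements Y

    1≤x : 1 ≤ x
    1≤x = ≤-trans (s≤s z≤n) 2≤x

    1≤loss : 1 ≤ loss x
    1≤loss = *-mono-≤ (*-mono-≤ (s≤s {n = 1} z≤n) 1≤x)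
      (m^n>0 (sample x) {{>-nonZero (*-mono-≤ (*-mono-≤ (s≤s {n = 1} z≤n) 1≤x) (m^n>0 x {{>-nonZero 1≤x}} t))}} t)

    no-clique : ∀ {vs} → length vs ≡ x → All (_∈ V G) vs → ¬ AllPairs _~_ vs
    no-clique len vs∈ cl = <⇒≱ ω<x (≤-trans (≤-reflexive (sym len)) (clique-length≤ω G vs∈ cl))

    small-count : ∀ {v} → v ∈ V H → x′ * count (dist≤? H r v) ys ≤ length ys
    small-count {v} v∈ = subst₂ (λ a b → x′ * a ≤ b) (∣ball∩∣≡count H r v Y) (sym (length-elements Y)) (small-balls v∈)

    Bad : Pred (Fin n) 0ℓ
    Bad v = v ∈ V H × ¬ x * ∣ N[ suc r ] H v ∩ Y ∣ ≤ ∣ Y ∣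

    bad? : Decidable Bad
    bad? v = (v ∈? V H) ×-dec ¬? (_ ≤? _)

    bad : Subset n
    bad = tabulate (does ∘ bad?)

    module _ (A : Fin t → Fin n) (A∈V : ∀ i → A i ∈ V H)
             (A-indep : ∀ {i i′} → i ≢ i′ → A i ≢ A i′ × ¬ A i ~ A i′) where

      -- Distance exactly `suc r` from every `A i`, with the first step of a shortest walk split
      -- off. The remaining walks of length exactly `r` form the bag of `y`, and the negative part
      -- keeps every `A i` out of it.
      Far : Fin n → Set
      Far y = ∀ i → ¬ Dist≤ H r (A i) y × (∃[ w ] (Graph._~_ H (A i) w × Walk H r w y))

      Reached : Set
      Reached = ∃ Far

      bag : Reached → Fin k → Fin n
      bag (y , far) p = let i , j = remQuot (suc r) p in vertex (proj₂ (proj₂ (proj₂ (far i)))) j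

      walk : ∀ (y : Reached) i → Walk H r _ (proj₁ y)
      walk (_ , far) i = proj₂ (proj₂ (proj₂ (far i)))

      bag-combine : ∀ y i j → bag y (combine i j) ≡ vertex (walk y i) j
      bag-combine y i j = cong (λ (i , j) → vertex (walk y i) j) (remQuot-combine i j)

      bag∈V : ∀ y p → bag y p ∈ V H
      bag∈V y p = let i , j = remQuot (suc r) p in vertex∈V (walk y i) j

      bag-dist : ∀ y p → Dist≤ H r (bag y p) (proj₁ y)
      bag-dist y p = let i , j = remQuot (suc r) p in vertex-dist (walk y i) j

      Meet : Reached → Reached → Set
      Meet y z = ∃[ p ] ∃[ q ] bag y p ≡ bag z q

      meet? : Decidable₂ Meet
      meet? y z = any? λ p → any? λ q → bag y p ≟ bag z q

      -- The last position on the first walk. All walks of a bag end in its vertex `y`, so this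
      -- position holds `y`.
      root : Fin k
      root = combine (fromℕ< 1≤t) (fromℕ r)

      bag-root : ∀ y → bag y root ≡ proj₁ y
      bag-root y = trans (bag-combine y (fromℕ< 1≤t) (fromℕ r)) (vertex-last (walk y (fromℕ< 1≤t)))

      -- The `A i` and the bags would form a model of `K t t`: `A i` is adjacent to the start of the
      -- `i`-th walk of each bag, and it lies in no bag because bags stay within distance `r` of
      -- their `y`.
      no-separated-bags : (f : Fin t → Reached) →
        ¬ (∀ {i j} → i ≢ j → ∀ p q → bag (f i) p ≢ bag (f j) q × ¬ bag (f i) p ~ bag (f j) q)
      no-separated-bags f f-sep = no-K
        (K≼ G A (bag ∘ f) (λ _ → root) (λ i → p─q⊆p _ _ (A∈V i)) (λ j p → p─q⊆p _ _ (bag∈V (f j) p))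
          A-indep f-sep A≢bag A~bag bag-connected)
        where
        A≢bag : ∀ i j p → A i ≢ bag (f j) p
        A≢bag i j p eq = proj₁ (proj₂ (f j) i) (subst (λ a → Dist≤ H r a (proj₁ (f j))) (sym eq) (bag-dist (f j) p))
        A~bag : ∀ i j → ∃[ p ] A i ~ bag (f j) p
        A~bag i j = combine i zero , subst (A i ~_) (sym (bag-combine (f j) i zero)) (proj₁ (proj₁ (proj₂ (proj₂ (proj₂ (f j) i)))))
        bag-connected : ∀ j p → Star (λ a b → a ~ b × (∃[ q ] bag (f j) q ≡ a) × (∃[ q ] bag (f j) q ≡ b))
                                     (bag (f j) p) (bag (f j) root)
        bag-connected j p = let i , l = remQuot (suc r) p in
          subst (Star _ (bag (f j) p)) (sym (bag-root (f j)))
            (Star.map (λ ((e , _) , a , b) → e , a , b)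
               (vertex-connected (λ a → ∃[ q ] bag (f j) q ≡ a) (walk (f j) i) (λ l → combine i l , bag-combine (f j) i l) l))

      -- If the far vertices made up a fraction `1 / (2 * loss x)` of `Y`, sparse `r`-balls would
      -- let `threshold x` pairwise disjoint bags be chosen greedily, and `separate` would find `t`
      -- anticomplete ones among them.
      far-few : ∀ {ys₁} → All Far ys₁ → (∀ {P : Pred (Fin n) 0ℓ} (P? : Decidable P) → count P? ys₁ ≤ count P? ys) →
               1 ≤ length ys₁ → ¬ length ys ≤ 2 * loss x * length ys₁
      far-few {ys₁} all-far sub 1≤ys₁ ys≤ =
        let Z , len , _ , Z-disj = disjoint
            f , _ , f-sep = separate G x 1≤x no-K no-clique bag (λ y p → p─q⊆p _ _ (bag∈V y p)) Z
              (AllPairs.map (λ (_ , ¬meet) p q eq → ¬meet (p , q , eq)) Z-disj)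
              (≤-reflexive (sym len))
        in no-separated-bags f f-sep
        where
        open ≤-Reasoning
        zs : List Reached
        zs = All.toList all-far
        N = threshold x
        Z≡ : length zs ≡ length ys₁
        Z≡ = trans (sym (length-map proj₁ zs)) (cong length (map-proj₁-toList all-far))

        ball-count : ∀ v → v ∈ V H → x′ * count (dist≤? H r v ∘ proj₁) zs ≤ 2 * loss x * length zs
        ball-count v v∈ = begin
          x′ * count (dist≤? H r v ∘ proj₁) zs          ≡⟨ cong (x′ *_) (count-map (dist≤? H r v) proj₁ zs) ⟩
          x′ * count (dist≤? H r v) (map proj₁ zs)      ≡⟨ cong (λ l → x′ * count (dist≤? H r v) l) (map-proj₁-toList all-far) ⟩
          x′ * count (dist≤? H r v) ys₁                 ≤⟨ *-monoʳ-≤ x′ (sub (dist≤? H r v)) ⟩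
          x′ * count (dist≤? H r v) ys                  ≤⟨ small-count v∈ ⟩
          length ys                                     ≤⟨ ys≤ ⟩
          2 * loss x * length ys₁                       ≡⟨ cong (2 * loss x *_) Z≡ ⟨
          2 * loss x * length zs                        ∎

        -- A bag meeting that of `y` has its end within distance `r` of one of the `k` vertices of
        -- the latter, so `k` sparse balls contain all these ends.
        degree : ∀ {y} → y List.∈ zs → N * suc (count (meet? y) zs) ≤ length zs
        degree {y} y∈ = *-cancelˡ-≤ (k * (2 * loss x)) {{>-nonZero (*-mono-≤ 1≤k (*-mono-≤ (s≤s {n = 1} z≤n) 1≤loss))}} (begin
          -- Every bag meets itself, so `d` is at least 1 and `suc d` is at most `d + d`.
          k * (2 * loss x) * (N * suc d)                ≤⟨ *-monoʳ-≤ (k * (2 * loss x)) (*-monoʳ-≤ N (+-monoˡ-≤ d 1≤d)) ⟩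
          k * (2 * loss x) * (N * (d + d))              ≡⟨ regroup (k * (2 * loss x)) N d ⟩
          -- The third summand of `scale x` is made for this comparison.
          2 * N * (k * (2 * loss x)) * d                ≤⟨ *-monoˡ-≤ d (≤-trans (m≤n+m _ (x + 2 * t * loss x)) scale≤x′) ⟩
          x′ * d                                        ≤⟨ cover-bound near? (allFin k) met x′ (2 * loss x * length zs) covered
                                                             (λ {p} _ → ≤-trans (*-monoʳ-≤ x′ (count-filter (near? p) (meet? y) zs)) (ball-count (bag y p) (bag∈V y p))) ⟩
          length (allFin k) * (2 * loss x * length zs)  ≡⟨ cong (_* (2 * loss x * length zs)) (length-tabulate {n = k} (λ i → i)) ⟩
          k * (2 * loss x * length zs)                  ≡⟨ *-assoc k (2 * loss x) _ ⟨
          k * (2 * loss x) * length zs                  ∎)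
          where
          met = filter (meet? y) zs
          d = length met
          near? : Decidable₂ (λ p z → Dist≤ H r (bag y p) (proj₁ z))
          near? p z = dist≤? H r (bag y p) (proj₁ z)
          1≤d : 1 ≤ d
          1≤d = ∈-length (∈-filter⁺ (meet? y) y∈ (root , root , refl))
          covered : ∀ {z} → z List.∈ met → ∃[ p ] (p List.∈ allFin k × Dist≤ H r (bag y p) (proj₁ z))
          covered {z} z∈ = let p , q , eq = proj₂ (∈-filter⁻ (meet? y) {xs = zs} z∈) in
            p , ∈-allFin p , subst (λ a → Dist≤ H r a (proj₁ z)) (sym eq) (bag-dist z q)
          regroup : ∀ a N d → a * (N * (d + d)) ≡ 2 * N * a * d
          regroup = solve-∀

        disjoint : ∃[ Z ] (length Z ≡ N × All (List._∈ zs) Z × AllPairs (λ y z → ⊤ × ¬ Meet y z) Z)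
        -- `N` is both the number of bags wanted and the reciprocal of the degree bound, so the size
        -- condition holds with equality.
        disjoint = greedy-independent meet? N (length zs) (≤-trans 1≤ys₁ (≤-reflexive (sym Z≡))) N zs
                     (trivial zs) degree ≤-refl
          where
          trivial : ∀ l → AllPairs (λ (_ _ : Reached) → ⊤) l
          trivial []      = []
          trivial (_ ∷ l) = All.universal (λ _ → tt) l ∷ trivial l

    -- Each bad vertex reaches more than `1 / x` of `Y`, so double counting gives `t` independent
    -- bad vertices with a common reach of at least `1 / loss x` of `Y`. At most half of that lies
    -- within distance `r` of one of them; the rest is far and contradicts `far-few`.
    bad-few : ¬ sample x ≤ ∣ bad ∣
    bad-few many = far-few centre centre∈V centre-indep ys₁-far ys₁-sub 1≤ys₁ ys≤
      where
      open ≤-Reasoning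
      bs = take (sample x) (elements bad)

      R? : Decidable₂ (Dist≤ H (suc r))
      R? = dist≤? H (suc r)

      Stable : Vec (Fin n) t → Set
      Stable T = ∀ i j → i ≢ j → lookup T i ≢ lookup T j × ¬ lookup T i ~ lookup T j

      stable? : Decidable Stable
      stable? T = all? λ i → all? λ j → ¬? (i ≟ j) →-dec
        (¬? (lookup T i ≟ lookup T j) ×-dec ¬? (lookup T i ~? lookup T j))

      bs-bad : All Bad bs
      bs-bad = All.take⁺ (sample x) (All.tabulate (∈-tabulate⁻ bad? ∘ ∈-elements⁻))

      bs-deg : ∀ {b} → b List.∈ bs → length ys ≤ x * count (R? b) ys
      bs-deg {b} b∈ = begin
        length ys                          ≡⟨ length-elements Y ⟩
        ∣ Y ∣                              ≤⟨ <⇒≤ (≰⇒> (proj₂ (All.lookup bs-bad b∈))) ⟩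
        x * ∣ N[ suc r ] H b ∩ Y ∣         ≡⟨ cong (x *_) (∣ball∩∣≡count H (suc r) b Y) ⟩
        x * count (R? b) ys                ∎

      1≤q : 1 ≤ x ^ t
      1≤q = m^n>0 x {{>-nonZero 1≤x}} t

      length-bs : length bs ≡ sample x
      length-bs = trans (length-take (sample x) (elements bad))
        (m≤n⇒m⊓n≡m (≤-trans many (≤-reflexive (sym (length-elements bad)))))

      -- If `Y` were empty, no vertex could be bad.
      1≤ys : 1 ≤ length ys
      1≤ys = let b , b∈ = nonempty (≤-trans 1≤sample (≤-reflexive (sym length-bs))) in
             ≰⇒> λ ys≤0 → proj₂ (All.lookup bs-bad b∈) (begin
               x * ∣ N[ suc r ] H b ∩ Y ∣  ≡⟨ cong (x *_) (∣ball∩∣≡count H (suc r) b Y) ⟩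
               x * count (R? b) ys         ≤⟨ *-monoʳ-≤ x (≤-trans (length-filter (R? b) ys) ys≤0) ⟩
               x * 0                       ≡⟨ *-zeroʳ x ⟩
               0                           ≤⟨ z≤n ⟩
               ∣ Y ∣                       ∎)
        where
        1≤sample : 1 ≤ sample x
        1≤sample = *-mono-≤ (*-mono-≤ (s≤s {n = 1} z≤n) 1≤x) 1≤q

      find-stable : ∀ y → x ^ t ≤ count (flip R? y) bs →
                    ∃[ f ] ((∀ i → f i List.∈ filter (flip R? y) bs) × Stable (tabulate f))
      find-stable y rich =
        let near = filter (flip R? y) bs
            vs , len , vs⊆ , ind = ramsey {V = _∈ V G} _~?_ x 1≤x no-clique t
              (All.map (p─q⊆p _ _ ∘ proj₁) (All.filter⁺ (flip R? y) bs-bad))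
              (Unique.filter⁺ (flip R? y) (Unique.take⁺ (sample x) (elements-unique bad))) rich
            f , f∈ , f-ind = AllPairs-lookup {S = λ u v → u ≢ v × ¬ u ~ v}
              (λ (ne , na) → ne ∘ sym , na ∘ ~-sym) len ind
        in f , All.lookup vs⊆ ∘ f∈ , λ i j i≢j → lookup∘tabulate⁺₂ (λ u v → u ≢ v × ¬ u ~ v) f (f-ind i≢j)

      common : _
      common = common-neighbours R? t stable? x (x ^ t) bs ys 1≤x 1≤q length-bs 1≤ys bs-deg find-stable

      centre : Fin t → Fin n
      centre = lookup (proj₁ common)

      centre∈V : ∀ i → centre i ∈ V H
      centre∈V i = proj₁ (All.lookup bs-bad (proj₁ (proj₂ common) i))

      centre-indep : ∀ {i i′} → i ≢ i′ → centre i ≢ centre i′ × ¬ centre i ~ centre i′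
      centre-indep = proj₁ (proj₂ (proj₂ common)) _ _

      within? : Decidable (λ y → ∀ i → Dist≤ H (suc r) (centre i) y)
      within? y = all? λ i → R? (centre i) y

      near? : Decidable (λ y → ∃[ i ] Dist≤ H r (centre i) y)
      near? y = any? λ i → dist≤? H r (centre i) y

      ys₀ = filter within? ys
      ys₁ = filter (¬? ∘ near?) ys₀

      ys₁-sub : ∀ {P : Pred (Fin n) 0ℓ} (P? : Decidable P) → count P? ys₁ ≤ count P? ys
      ys₁-sub P? = ≤-trans (count-filter P? (¬? ∘ near?) ys₀) (count-filter P? within? ys)

      ys₁-far : All (Far centre centre∈V centre-indep) ys₁
      ys₁-far = All.tabulate λ {y} y∈ i →
        let y∈ys₀ , ¬near = ∈-filter⁻ (¬? ∘ near?) {xs = ys₀} y∈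
            l , l≤1+r , p = proj₂ (∈-filter⁻ within? {xs = ys} y∈ys₀) i
        in (λ d → ¬near (i , d)) , first-step (λ d → ¬near (i , d)) l≤1+r p
        where
        -- A walk of length at most `r` is excluded, so the length is exactly `suc r` and a first
        -- edge exists.
        first-step : ∀ {l a y} → ¬ Dist≤ H r a y → l ≤ suc r → Walk H l a y →
                     ∃[ w ] (Graph._~_ H a w × Walk H r w y)
        first-step {l} far l≤1+r p with l ℕ.≟ suc r
        first-step far l≤1+r (e ∷ p) | yes refl = _ , e , p
        first-step far l≤1+r p       | no l≢    = contradiction (_ , s≤s⁻¹ (≤∧≢⇒< l≤1+r l≢) , p) far

      near-few : 2 * count near? ys₀ ≤ length ys₀
      near-few = *-cancelˡ-≤ (t * loss x) {{>-nonZero (*-mono-≤ 1≤t 1≤loss)}} (begin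
        t * loss x * (2 * d)              ≡⟨ regroup t (loss x) d ⟩
        -- The second summand of `scale x` is made for this comparison.
        2 * t * loss x * d                ≤⟨ *-monoˡ-≤ d (≤-trans (m≤n+m _ x) (≤-trans (m≤m+n _ _) scale≤x′)) ⟩
        x′ * d                            ≤⟨ cover-bound nearAt? (allFin t) (filter near? ys₀) x′ (length ys)
                                               (λ y∈ → let i , dist = proj₂ (∈-filter⁻ near? {xs = ys₀} y∈) in i , ∈-allFin i , dist)
                                               (λ {i} _ → ≤-trans (*-monoʳ-≤ x′ (≤-trans (count-filter (nearAt? i) near? ys₀)
                                                                                          (count-filter (nearAt? i) within? ys)))
                                                                  (small-count (centre∈V i))) ⟩
        length (allFin t) * length ys     ≡⟨ cong (_* length ys) (length-tabulate {n = t} (λ i → i)) ⟩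
        t * length ys                     ≤⟨ *-monoʳ-≤ t ys≤₀ ⟩
        t * (loss x * length ys₀)         ≡⟨ *-assoc t (loss x) _ ⟨
        t * loss x * length ys₀           ∎)
        where
        d = count near? ys₀
        nearAt? : Decidable₂ (λ i y → Dist≤ H r (centre i) y)
        nearAt? i y = dist≤? H r (centre i) y
        ys≤₀ : length ys ≤ loss x * length ys₀
        ys≤₀ = proj₂ (proj₂ (proj₂ common))
        regroup : ∀ t l d → t * l * (2 * d) ≡ 2 * t * l * d
        regroup = solve-∀

      ys₀≤ : length ys₀ ≤ 2 * length ys₁
      ys₀≤ = +-cancelˡ-≤ (length ys₀) _ _ (begin
        length ys₀ + length ys₀                       ≡⟨ cong (λ m → length ys₀ + m) (+-identityʳ _) ⟨
        2 * length ys₀                                ≡⟨ cong (2 *_) (count-∁ near? ys₀) ⟨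
        2 * (count near? ys₀ + length ys₁)            ≡⟨ *-distribˡ-+ 2 (count near? ys₀) _ ⟩
        2 * count near? ys₀ + 2 * length ys₁          ≤⟨ +-monoˡ-≤ _ near-few ⟩
        length ys₀ + 2 * length ys₁                   ∎)

      ys≤ : length ys ≤ 2 * loss x * length ys₁
      ys≤ = begin
        length ys                       ≤⟨ proj₂ (proj₂ (proj₂ common)) ⟩
        loss x * length ys₀             ≤⟨ *-monoʳ-≤ (loss x) ys₀≤ ⟩
        loss x * (2 * length ys₁)       ≡⟨ regroup (loss x) (length ys₁) ⟩
        2 * loss x * length ys₁         ∎
        where
        regroup : ∀ l y → l * (2 * y) ≡ 2 * l * y
        regroup = solve-∀

      1≤ys₁ : 1 ≤ length ys₁
      1≤ys₁ = positive-factor (2 * loss x) 1≤ys ys≤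

    -- Removing further vertices only shrinks balls, and a surviving vertex was not bad in `H`.
    balls-outside-bad : ∀ {v} → v ∈ V G ─ (X ∪ bad) → x * ∣ N[ suc r ] (G ∖ (X ∪ bad)) v ∩ Y ∣ ≤ ∣ Y ∣
    balls-outside-bad {v} v∈ = ≤-trans (*-monoʳ-≤ x (p⊆q⇒∣p∣≤∣q∣ shrink)) (decidable-stable (_ ≤? _) λ ¬small →
      v∉ (x∈p∪q⁺ (inj₂ (∈-tabulate⁺ bad? (x∈p∧x∉q⇒x∈p─q (p─q⊆p _ _ v∈) (v∉ ∘ x∈p∪q⁺ ∘ inj₁) , ¬small)))))
      where
      H′ = G ∖ (X ∪ bad)
      v∉ = x∈p─q⇒x∉q (V G) (X ∪ bad) v∈
      shrink : N[ suc r ] H′ v ∩ Y ⊆ N[ suc r ] H v ∩ Y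
      shrink w∈ = let w∈N , w∈Y = x∈p∩q⁻ (N[ suc r ] H′ v) Y w∈
                      l , l≤ , p = ∈-tabulate⁻ (dist≤? H′ (suc r) v) w∈N
                  in x∈p∩q⁺ (∈-tabulate⁺ (dist≤? H (suc r) v) (l , l≤ , Walk-∖-antitone G (x∈p∪q⁺ ∘ inj₁) p) , w∈Y)

    X∪bad⊆V : X ⊆ V G → X ∪ bad ⊆ V G
    X∪bad⊆V X⊆V v∈ = [ X⊆V , (λ v∈bad → p─q⊆p _ _ (proj₁ (∈-tabulate⁻ bad? v∈bad))) ]′ (x∈p∪q⁻ X bad v∈)

    ∣X∪bad∣≤ : ∣ X ∪ bad ∣ ≤ ∣ X ∣ + sample x
    ∣X∪bad∣≤ = ≤-trans (∣p∪q∣≤∣p∣+∣q∣ X bad) (+-monoʳ-≤ ∣ X ∣ (<⇒≤ (≰⇒> bad-few)))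

  -- The induction hypothesis is applied at a power `x ^ a` that is at least `scale x`. The size
  -- `(x ^ a) ^ e` of the first removed set is then again a power of `x`, to which the bad vertices
  -- add at most `sample x`.
  sparse-suc : SparseBalls t r → SparseBalls t (suc r)
  sparse-suc (e , sparse) = combine-bounds scaleᵖ
    where
    combine-bounds : PolyBounded scale → SparseBalls t (suc r)
    combine-bounds (a , scale≤) = proj₁ sizeᵖ , λ x 2≤x G no-K ω<x Y Y⊆V →
      let x≤x^a = ≤-trans (≤-trans (m≤m+n x _) (m≤m+n _ _)) (scale≤ x 2≤x)
          X , X⊆V , ∣X∣≤ , small = sparse (x ^ a) (≤-trans 2≤x x≤x^a) G no-K (≤-trans ω<x x≤x^a) Y Y⊆V
      in X ∪ bad G x 2≤x no-K ω<x X Y (x ^ a) (scale≤ x 2≤x) small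
         , X∪bad⊆V G x 2≤x no-K ω<x X Y (x ^ a) (scale≤ x 2≤x) small X⊆V
         , ≤-trans (∣X∪bad∣≤ G x 2≤x no-K ω<x X Y (x ^ a) (scale≤ x 2≤x) small)
             (≤-trans (+-monoˡ-≤ (sample x) ∣X∣≤) (proj₂ sizeᵖ x 2≤x))
         , balls-outside-bad G x 2≤x no-K ω<x X Y (x ^ a) (scale≤ x 2≤x) small
      where
      sizeᵖ : PolyBounded (λ x → (x ^ a) ^ e + sample x)
      sizeᵖ = (idᵖ ^ᵖ a) ^ᵖ e +ᵖ sampleᵖ

sparse-balls : ∀ t → 1 ≤ t → ∀ r → SparseBalls t r
sparse-balls t 1≤t zero    = sparse-zero t
sparse-balls t 1≤t (suc r) = Step.sparse-suc t r 1≤t (sparse-balls t 1≤t r)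

-- The polynomial bound in terms of `C * s`

monomial : ℕ → Polynomial
monomial zero    = 1 ∷ []
monomial (suc e) = 0 ∷ monomial e

eval-monomial : ∀ e x → eval (monomial e) x ≡ x ^ e
eval-monomial zero    x = cong suc (*-zeroʳ x)
eval-monomial (suc e) x = cong (x *_) (eval-monomial e x)

*≤⇒≤/ : ∀ a b C .{{_ : NonZero C}} → C * a ≤ b → (+ a) / 1 ≤ᵘ (+ b) / C
*≤⇒≤/ a b (suc c) le = *≤* (subst₂ ℤ._≤_
  (trans (cong +_ (*-comm (suc c) a)) (ℤ.pos-* a (suc c))) (sym (ℤ.*-identityʳ (+ b))) (ℤ.+≤+ le))

theorem1p6 : ∀ (t r : ℕ) .{{_ : NonZero t}} .{{_ : NonZero r}} →
    Σ[ f ∈ Polynomial ] (∀ (C s : ℕ) .{{_ : NonZero C}} .{{_ : NonZero s}} → 2 ≤ C →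
    ∀ {n : ℕ} (G : Graph n) → InducedMinorFree (K t t) G → ω G < s →
    ∀ (Y : Subset n) → Y ⊆ V G →
    Σ[ X ∈ Subset n ] (X ⊆ V G
    × ∣ X ∣ ≤ eval f (C * s)
    × (∀ (v : Fin n) → v ∈ V G ─ X →
    (+ ∣ N[ r ] (G ∖ X) v ∩ Y ∣) / 1 ≤ᵘ (+ ∣ Y ∣) / C)))
theorem1p6 t r = let e , sparse = sparse-balls t (>-nonZero⁻¹ t) r in
  monomial e , λ C s 2≤C G no-K ω<s Y Y⊆V →
    let 1≤s = >-nonZero⁻¹ s
        C≤Cs = m≤m*n C s
        s≤Cs = m≤n*m s C
        -- `C * s` is at least `C` and at least `s`, so it can serve as the single parameter; the
        -- fraction obtained is `1 / (C * s)`, which is at most `1 / C`.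
        X , X⊆V , ∣X∣≤ , balls = sparse (C * s) (≤-trans 2≤C C≤Cs) G no-K (≤-trans ω<s s≤Cs) Y Y⊆V
    in X , X⊆V , ≤-trans ∣X∣≤ (≤-reflexive (sym (eval-monomial e (C * s))))
       , λ v v∈ → *≤⇒≤/ _ _ C (≤-trans (*-monoˡ-≤ _ C≤Cs) (balls v∈))
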